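{- Let $\mathcal{R}\subseteq\mathbb{R}^2$ be the set of all $(r_0,r_1)\in\mathbb{R}^2$ that belong to none of the following sets: (1) $\{ -2<r_0+r_1<0\}$; (2) $\{r_1=r_0+1\}$; (3) $\{ -2<r_0\le -1,\ -1<r_1\le 0\}$; (4) $\{ -1\le r_0<0,\ 0\le r_1<1\}$; (5) $\{r_0>0,\ r_1\le -2\sqrt{r_0},\ r_0+r_1\ge 0\}$; (6) $\{r_0+r_1\le -2,\ r_0-r_1\ne -1\}\setminus\{r_0>-2,\ r_1>-1\}$; (7) $\{r_0+r_1\ge 0,\ r_0<0,\ r_1\ge 1\}$; (8) $\{r_0-r_1<-1,\ r_0\ge 0\}$; (9) $\{r_0-r_1>-\tfrac12,\ r_1\ge\max\{ -2\sqrt{r_0},-r_0\},\ r_0>\tfrac32+\sqrt2\}$; (10) $\{ -1<r_0-r_1\le-\tfrac12,\ r_1\ge 1+\sqrt5,\ r_1^2\ge 4r_0\}$. Then $\mathcal{R}\cap\{(x,y)\in\mathbb{R}^2\mid x\ge \tfrac43\}\subset\mathcal{D}_2^{(*)}$.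
   Context: For $\mathbf{r}=(r_0,r_1)\in\mathbb{R}^2$, the two-dimensional shift radix system is the map $\tau_{\mathbf{r}}:\mathbb{Z}^2\to\mathbb{Z}^2$, $\tau_{\mathbf{r}}(a_0,a_1)=(a_1,-\lfloor r_0a_0+r_1a_1\rfloor)$. The orbit of $(a_0,a_1)$ is identified with the integer sequence $(a_n)_{n\ge 0}$ where $a_{n+2}=-\lfloor r_0a_n+r_1a_{n+1}\rfloor$ for $n\ge0$. An orbit is ultimately periodic if there are $n_0\ge 0$, $p>0$ with $a_{n+p}=a_n$ for all $n\ge n_0$; it ends up in the trivial cycle if $a_n=0$ for all sufficiently large $n$. $\mathcal{D}_2^{(*)}$ is the set of all $\mathbf{r}\in\mathbb{R}^2$ such that each ultimately periodic orbit of $\tau_{\mathbf{r}}$ ends up in the trivial cycle. In the definition of $\mathcal{R}$ each listed set is a set of points $(r_0,r_1)\in\mathbb{R}^2$. -}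

module Defs where

open import Data.Empty using (⊥-elim)
open import Data.Integer as ℤ using (ℤ; +_)
import Data.Integer.DivMod as ℤ
import Data.Integer.Properties as ℤ
open import Data.Nat as ℕ using (ℕ; zero; suc; z≤n; s≤s)
import Data.Nat.Properties as ℕ
open import Data.Product using (∃; _×_; _,_; proj₁; proj₂)
open import Data.Rational as ℚ using (ℚ; 0ℚ; 1ℚ; ½; ∣_∣; *≤*; *<*; ↥_; ↧_; 1/_)
import Data.Rational.Literals as ℚ
import Data.Rational.Properties as ℚ
open import Data.Rational.Solver using (module +-*-Solver)
open import Data.Sum using (inj₁; inj₂)
open import Function using (_$_)
open import Level using (0ℓ)
open import Relation.Binary.Core using (Rel)
open import Relation.Binary.PropositionalEquality
open import Relation.Nullary using (¬_; yes; no)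
open import Relation.Unary using (Pred; ∁; _∪_)

private
  variable
    p q r ε : ℚ

private
  p-q≡-[q-p] : ∀ p q → p ℚ.- q ≡ ℚ.- (q ℚ.- p)
  p-q≡-[q-p] = solve 2 (λ p q → p :- q := :- (q :- p)) refl
    where open +-*-Solver

  ∣p-q∣≡∣q-p∣ : ∀ p q → ∣ p ℚ.- q ∣ ≡ ∣ q ℚ.- p ∣
  ∣p-q∣≡∣q-p∣ p q = trans (cong ∣_∣ (p-q≡-[q-p] p q)) (ℚ.∣-p∣≡∣p∣ (q ℚ.- p))

  p≤∣p∣ : ∀ p → p ℚ.≤ ∣ p ∣
  p≤∣p∣ p with ℚ.≤-total 0ℚ p
  ... | inj₁ 0≤p = ℚ.≤-reflexive (sym (ℚ.0≤p⇒∣p∣≡p 0≤p))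
  ... | inj₂ p≤0 = ℚ.≤-trans p≤0 (ℚ.0≤∣p∣ p)

  ∣p∣<ε : p ℚ.< ε → ℚ.- p ℚ.< ε → ∣ p ∣ ℚ.< ε
  ∣p∣<ε {p} p<ε -p<ε with ℚ.∣p∣≡p∨∣p∣≡-p p
  ... | inj₁ eq = subst (ℚ._< _) (sym eq) p<ε
  ... | inj₂ eq = subst (ℚ._< _) (sym eq) -p<ε

  ½+½ : ∀ p → ½ ℚ.* p ℚ.+ ½ ℚ.* p ≡ p
  ½+½ = solve 1 (λ p → con ½ :* p :+ con ½ :* p := p) refl
    where open +-*-Solver

  *-pos : 0ℚ ℚ.< p → 0ℚ ℚ.< q → 0ℚ ℚ.< p ℚ.* q
  *-pos {p} {q} 0<p 0<q = subst (ℚ._< p ℚ.* q) (ℚ.*-zeroʳ p)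
    (ℚ.*-monoʳ-<-pos p {{ℚ.positive 0<p}} 0<q)

  *-nonNeg : 0ℚ ℚ.≤ p → 0ℚ ℚ.≤ q → 0ℚ ℚ.≤ p ℚ.* q
  *-nonNeg {p} {q} 0≤p 0≤q = subst (ℚ._≤ p ℚ.* q) (ℚ.*-zeroʳ p)
    (ℚ.*-monoˡ-≤-nonNeg p {{ℚ.nonNegative 0≤p}} 0≤q)

  +-nonNeg : 0ℚ ℚ.≤ p → 0ℚ ℚ.≤ q → 0ℚ ℚ.≤ p ℚ.+ q
  +-nonNeg = ℚ.+-mono-≤ {0ℚ} {_} {0ℚ}

  ⊔ˡ : ∀ M N {o} → M ℕ.⊔ N ℕ.≤ o → M ℕ.≤ o
  ⊔ˡ M N = ℕ.m⊔n≤o⇒m≤o M N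

  ⊔ʳ : ∀ M N {o} → M ℕ.⊔ N ℕ.≤ o → N ℕ.≤ o
  ⊔ʳ M N = ℕ.m⊔n≤o⇒n≤o M N

  0<½ : 0ℚ ℚ.< ½
  0<½ = ℚ.positive⁻¹ ½

  0<1 : 0ℚ ℚ.< 1ℚ
  0<1 = ℚ.positive⁻¹ 1ℚ

  *-close : ∀ {a b c d A D δ} → 0ℚ ℚ.< A → 0ℚ ℚ.< D →
            ∣ a ∣ ℚ.< A → ∣ d ∣ ℚ.< D → ∣ a ℚ.- c ∣ ℚ.< δ → ∣ b ℚ.- d ∣ ℚ.< δ →
            ∣ a ℚ.* b ℚ.- c ℚ.* d ∣ ℚ.< (A ℚ.+ D) ℚ.* δ
  *-close {a} {b} {c} {d} {A} {D} {δ} 0<A 0<D a<A d<D a-c b-d = begin-strict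
    ∣ a ℚ.* b ℚ.- c ℚ.* d ∣
      ≡⟨ cong ∣_∣ (split a b c d) ⟩
    ∣ a ℚ.* (b ℚ.- d) ℚ.+ d ℚ.* (a ℚ.- c) ∣
      ≤⟨ ℚ.∣p+q∣≤∣p∣+∣q∣ (a ℚ.* (b ℚ.- d)) (d ℚ.* (a ℚ.- c)) ⟩
    ∣ a ℚ.* (b ℚ.- d) ∣ ℚ.+ ∣ d ℚ.* (a ℚ.- c) ∣
      ≡⟨ cong₂ ℚ._+_ (ℚ.∣p*q∣≡∣p∣*∣q∣ a (b ℚ.- d)) (ℚ.∣p*q∣≡∣p∣*∣q∣ d (a ℚ.- c)) ⟩
    ∣ a ∣ ℚ.* ∣ b ℚ.- d ∣ ℚ.+ ∣ d ∣ ℚ.* ∣ a ℚ.- c ∣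
      <⟨ ℚ.+-mono-< (mul 0<A a<A b-d) (mul 0<D d<D a-c) ⟩
    A ℚ.* δ ℚ.+ D ℚ.* δ
      ≡⟨ sym (ℚ.*-distribʳ-+ δ A D) ⟩
    (A ℚ.+ D) ℚ.* δ ∎
    where
    open ℚ.≤-Reasoning
    split : ∀ a b c d → a ℚ.* b ℚ.- c ℚ.* d ≡ a ℚ.* (b ℚ.- d) ℚ.+ d ℚ.* (a ℚ.- c)
    split = solve 4 (λ a b c d → a :* b :- c :* d := a :* (b :- d) :+ d :* (a :- c)) refl
      where open +-*-Solver
    mul : ∀ {x y X} → 0ℚ ℚ.< X → ∣ x ∣ ℚ.< X → ∣ y ∣ ℚ.< δ → ∣ x ∣ ℚ.* ∣ y ∣ ℚ.< X ℚ.* δ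
    mul {x} {y} {X} 0<X x<X y<δ = ℚ.≤-<-trans
      (ℚ.*-monoʳ-≤-nonNeg ∣ y ∣ {{ℚ.∣-∣-nonNeg y}} (ℚ.<⇒≤ x<X))
      (ℚ.*-monoʳ-<-pos X {{ℚ.positive 0<X}} y<δ)

-- The reals are the setoid (ℝ , _≃_) of Cauchy sequences of rationals, with
-- termwise operations.
IsCauchy : Pred (ℕ → ℚ) 0ℓ
IsCauchy x = ∀ {ε} → 0ℚ ℚ.< ε →
  ∃ λ N → ∀ {m n} → N ℕ.≤ m → N ℕ.≤ n → ∣ x m ℚ.- x n ∣ ℚ.< ε

record ℝ : Set where
  constructor mkℝ
  field
    seq    : ℕ → ℚ
    cauchy : IsCauchy seq

open ℝ public

infix 4 _<_ _≤_ _≃_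

_<_ : Rel ℝ 0ℓ
x < y = ∃ λ ε → 0ℚ ℚ.< ε × ∃ λ N → ∀ {n} → N ℕ.≤ n → seq x n ℚ.+ ε ℚ.< seq y n

-- Equivalent to: for every ε > 0, eventually seq x n ≤ seq y n + ε.
_≤_ : Rel ℝ 0ℓ
x ≤ y = ¬ (y < x)

_≃_ : Rel ℝ 0ℓ
x ≃ y = ∀ {ε} → 0ℚ ℚ.< ε →
  ∃ λ N → ∀ {n} → N ℕ.≤ n → ∣ seq x n ℚ.- seq y n ∣ ℚ.< ε

private
  Short : (ℚ → ℚ → ℚ) → Set
  Short _∙_ = ∀ a b c d →
    ∣ (a ∙ b) ℚ.- (c ∙ d) ∣ ℚ.≤ ∣ a ℚ.- c ∣ ℚ.+ ∣ b ℚ.- d ∣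

  zipWith : (_∙_ : ℚ → ℚ → ℚ) → Short _∙_ → ℝ → ℝ → ℝ
  zipWith _∙_ short x y = mkℝ (λ n → seq x n ∙ seq y n) λ {ε} 0<ε →
    let 0<ε/2   = *-pos 0<½ 0<ε
        M , x-c = cauchy x 0<ε/2
        N , y-c = cauchy y 0<ε/2
    in M ℕ.⊔ N , λ {m} {n} ≤m ≤n → ℚ.≤-<-trans
         (short (seq x m) (seq y m) (seq x n) (seq y n))
         (subst (_ ℚ.<_) (½+½ ε) $ ℚ.+-mono-<
           (x-c (⊔ˡ M N ≤m) (⊔ˡ M N ≤n))
           (y-c (⊔ʳ M N ≤m) (⊔ʳ M N ≤n)))

  +-short : Short ℚ._+_
  +-short a b c d = ℚ.≤-trans (ℚ.≤-reflexive (cong ∣_∣ (eq a b c d)))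
    (ℚ.∣p+q∣≤∣p∣+∣q∣ (a ℚ.- c) (b ℚ.- d))
    where
    eq : ∀ a b c d → (a ℚ.+ b) ℚ.- (c ℚ.+ d) ≡ (a ℚ.- c) ℚ.+ (b ℚ.- d)
    eq = solve 4 (λ a b c d → (a :+ b) :- (c :+ d) := (a :- c) :+ (b :- d)) refl
      where open +-*-Solver

  ⊔-bound : ∀ a b c d → a ℚ.⊔ b ℚ.≤ c ℚ.⊔ d ℚ.+ (∣ a ℚ.- c ∣ ℚ.+ ∣ b ℚ.- d ∣)
  ⊔-bound a b c d = ℚ.⊔-lub
    (ℚ.≤-trans (ℚ.≤-reflexive (eq a c 0ℚ))
      (ℚ.+-mono-≤ (ℚ.p≤p⊔q c d) (ℚ.+-mono-≤ (p≤∣p∣ (a ℚ.- c)) (ℚ.0≤∣p∣ (b ℚ.- d)))))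
    (ℚ.≤-trans (ℚ.≤-reflexive (eq′ b d 0ℚ))
      (ℚ.+-mono-≤ (ℚ.p≤q⊔p c d) (ℚ.+-mono-≤ (ℚ.0≤∣p∣ (a ℚ.- c)) (p≤∣p∣ (b ℚ.- d)))))
    where
    open +-*-Solver
    eq : ∀ a c z → a ≡ c ℚ.+ ((a ℚ.- c) ℚ.+ 0ℚ)
    eq = solve 3 (λ a c z → a := c :+ ((a :- c) :+ con 0ℚ)) refl
    eq′ : ∀ a c z → a ≡ c ℚ.+ (0ℚ ℚ.+ (a ℚ.- c))
    eq′ = solve 3 (λ a c z → a := c :+ (con 0ℚ :+ (a :- c))) refl

  p≤q+r⇒p-q≤r : p ℚ.≤ q ℚ.+ r → p ℚ.- q ℚ.≤ r
  p≤q+r⇒p-q≤r {p} {q} {r} h = ℚ.≤-trans (ℚ.+-monoˡ-≤ (ℚ.- q) h)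
    (ℚ.≤-reflexive (eq q r))
    where
    eq : ∀ q r → q ℚ.+ r ℚ.- q ≡ r
    eq = solve 2 (λ q r → q :+ r :- q := r) refl
      where open +-*-Solver

  ⊔-short : Short ℚ._⊔_
  ⊔-short a b c d with ℚ.∣p∣≡p∨∣p∣≡-p ((a ℚ.⊔ b) ℚ.- (c ℚ.⊔ d))
  ... | inj₁ eq = ℚ.≤-trans (ℚ.≤-reflexive eq) (p≤q+r⇒p-q≤r (⊔-bound a b c d))
  ... | inj₂ eq = subst₂ ℚ._≤_
    (trans (p-q≡-[q-p] (c ℚ.⊔ d) (a ℚ.⊔ b)) (sym eq))
    (cong₂ ℚ._+_ (∣p-q∣≡∣q-p∣ c a) (∣p-q∣≡∣q-p∣ d b))
    (p≤q+r⇒p-q≤r (⊔-bound c d a b))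

  bounded : ∀ x → ∃ λ A → 0ℚ ℚ.< A × ∃ λ N → ∀ {n} → N ℕ.≤ n → ∣ seq x n ∣ ℚ.< A
  bounded x = A , 0<A , N , λ {n} N≤n → ℚ.≤-<-trans
    (ℚ.≤-trans (ℚ.≤-reflexive (cong ∣_∣ (eq (seq x n) (seq x N))))
      (ℚ.∣p+q∣≤∣p∣+∣q∣ (seq x n ℚ.- seq x N) (seq x N)))
    (ℚ.+-monoˡ-< ∣ seq x N ∣ (x-c N≤n ℕ.≤-refl))
    where
    N   = proj₁ (cauchy x 0<1)
    x-c = proj₂ (cauchy x 0<1)
    A   = 1ℚ ℚ.+ ∣ seq x N ∣
    0<A : 0ℚ ℚ.< A
    0<A = ℚ.+-mono-<-≤ 0<1 (ℚ.0≤∣p∣ (seq x N))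
    eq : ∀ a b → a ≡ a ℚ.- b ℚ.+ b
    eq = solve 2 (λ a b → a := a :- b :+ b) refl
      where open +-*-Solver

infix  8 -_
infixl 7 _*_
infixl 6 _+_ _-_ _⊔_

_+_ : ℝ → ℝ → ℝ
_+_ = zipWith ℚ._+_ +-short

-_ : ℝ → ℝ
- x = mkℝ (λ n → ℚ.- seq x n) λ 0<ε →
  let N , x-c = cauchy x 0<ε
  in N , λ {m} {n} ≤m ≤n → subst (ℚ._< _) (eq (seq x m) (seq x n)) (x-c ≤m ≤n)
  where
  eq : ∀ a b → ∣ a ℚ.- b ∣ ≡ ∣ ℚ.- a ℚ.- ℚ.- b ∣
  eq a b = trans (∣p-q∣≡∣q-p∣ a b) (cong ∣_∣ (lemma a b))
    where
    open +-*-Solver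
    lemma : ∀ a b → b ℚ.- a ≡ ℚ.- a ℚ.- ℚ.- b
    lemma = solve 2 (λ a b → b :- a := :- a :- :- b) refl

_-_ : ℝ → ℝ → ℝ
x - y = x + - y

_⊔_ : ℝ → ℝ → ℝ
_⊔_ = zipWith ℚ._⊔_ ⊔-short

_*_ : ℝ → ℝ → ℝ
x * y = mkℝ (λ n → seq x n ℚ.* seq y n) *-cauchy
  where
  *-cauchy : IsCauchy (λ n → seq x n ℚ.* seq y n)
  *-cauchy {ε} 0<ε =
    let A , 0<A , K , x<A = bounded x
        B , 0<B , L , y<B = bounded y
        0<A+B   = ℚ.+-mono-< 0<A 0<B
        instance
          A+B-pos = ℚ.positive 0<A+B
          A+B≢0   = ℚ.pos⇒nonZero (A ℚ.+ B)
        δ       = 1/ (A ℚ.+ B) ℚ.* ε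
        0<δ     = *-pos (ℚ.positive⁻¹ (1/ (A ℚ.+ B)) {{ℚ.1/pos⇒pos (A ℚ.+ B)}}) 0<ε
        eq      = trans (sym (ℚ.*-assoc (A ℚ.+ B) (1/ (A ℚ.+ B)) ε))
                    (trans (cong (ℚ._* ε) (ℚ.*-inverseʳ (A ℚ.+ B))) (ℚ.*-identityˡ ε))
        M , x-c = cauchy x 0<δ
        N , y-c = cauchy y 0<δ
    in (K ℕ.⊔ L) ℕ.⊔ (M ℕ.⊔ N) , λ {i} {j} ≤i ≤j → subst (_ ℚ.<_) eq $
         *-close {seq x i} {seq y i} {seq x j} {seq y j} 0<A 0<B
           (x<A (⊔ˡ K L (⊔ˡ (K ℕ.⊔ L) (M ℕ.⊔ N) ≤i))) (y<B (⊔ʳ K L (⊔ˡ (K ℕ.⊔ L) (M ℕ.⊔ N) ≤j)))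
           (x-c (⊔ˡ M N (⊔ʳ (K ℕ.⊔ L) (M ℕ.⊔ N) ≤i)) (⊔ˡ M N (⊔ʳ (K ℕ.⊔ L) (M ℕ.⊔ N) ≤j)))
           (y-c (⊔ʳ M N (⊔ʳ (K ℕ.⊔ L) (M ℕ.⊔ N) ≤i)) (⊔ʳ M N (⊔ʳ (K ℕ.⊔ L) (M ℕ.⊔ N) ≤j)))

fromℚ : ℚ → ℝ
fromℚ q = mkℝ (λ _ → q) λ {ε} 0<ε → 0 , λ _ _ →
  subst (λ a → ∣ a ∣ ℚ.< ε) (sym (ℚ.+-inverseʳ q)) 0<ε

fromℤ : ℤ → ℝ
fromℤ i = fromℚ (ℚ.fromℤ i)

isqrt : ℕ → ℕ
isqrt zero = zero
isqrt (suc n) with suc (isqrt n) ℕ.* suc (isqrt n) ℕ.≤? suc n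
... | yes _ = suc (isqrt n)
... | no  _ = isqrt n

isqrt-≤ : ∀ n → isqrt n ℕ.* isqrt n ℕ.≤ n
isqrt-≤ zero = z≤n
isqrt-≤ (suc n) with suc (isqrt n) ℕ.* suc (isqrt n) ℕ.≤? suc n
... | yes p = p
... | no  _ = ℕ.m≤n⇒m≤1+n (isqrt-≤ n)

isqrt-> : ∀ n → n ℕ.< suc (isqrt n) ℕ.* suc (isqrt n)
isqrt-> zero = s≤s z≤n
isqrt-> (suc n) with suc (isqrt n) ℕ.* suc (isqrt n) ℕ.≤? suc n
... | yes _ = ℕ.≤-<-trans (isqrt-> n)
  (ℕ.*-mono-< (ℕ.n<1+n (suc (isqrt n))) (ℕ.n<1+n (suc (isqrt n))))
... | no ¬p = ℕ.≰⇒> ¬p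

-- ⌊√(q (1+n)²)⌋ / (1+n), where negative q are first replaced by 0; hence √ x below
-- is the usual root for x ≥ 0 and 0 for x < 0.
approx√ : ℚ → ℕ → ℚ
approx√ q n = ℚ.fromℤ (+ isqrt ℤ.∣ ℚ.floor ((q ℚ.⊔ 0ℚ) ℚ.* (N ℚ.* N)) ∣) ℚ.* 1/ N
  where N = ℚ.fromℤ (+ suc n)

private
  fromℤ-* : ∀ i j → ℚ.fromℤ i ℚ.* ℚ.fromℤ j ≡ ℚ.fromℤ (i ℤ.* j)
  fromℤ-* i j = ℚ.↥p/↧p≡p (ℚ.fromℤ (i ℤ.* j))

  fromℤ-+ : ∀ i j → ℚ.fromℤ i ℚ.+ ℚ.fromℤ j ≡ ℚ.fromℤ (i ℤ.+ j)
  fromℤ-+ i j = trans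
    (cong (ℚ._/ 1) (cong₂ ℤ._+_ (ℤ.*-identityʳ i) (ℤ.*-identityʳ j)))
    (ℚ.↥p/↧p≡p (ℚ.fromℤ (i ℤ.+ j)))

  fromℤ-≤ : ∀ {i j} → i ℤ.≤ j → ℚ.fromℤ i ℚ.≤ ℚ.fromℤ j
  fromℤ-≤ i≤j = *≤* (ℤ.*-monoʳ-≤-nonNeg (+ 1) i≤j)

  floor-nonNeg : 0ℚ ℚ.≤ q → + 0 ℤ.≤ ℚ.floor q
  floor-nonNeg {q@record{}} (*≤* 0≤q) = ℤ.0≤n⇒0≤n/d (↥ q) (↧ q)
    (subst (+ 0 ℤ.≤_) (ℤ.*-identityʳ (↥ q)) 0≤q) (ℤ.+≤+ z≤n)

  floor-≤ : ∀ q → ℚ.fromℤ (ℚ.floor q) ℚ.≤ q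
  floor-≤ q@record{} = *≤* (ℤ.≤-trans (ℤ.[n/d]*d≤n (↥ q) (↧ q))
    (ℤ.≤-reflexive (sym (ℤ.*-identityʳ (↥ q)))))

  floor-> : ∀ q → q ℚ.< ℚ.fromℤ (ℤ.suc (ℚ.floor q))
  floor-> q@record{} = *<* (subst₂ ℤ._<_ (sym (ℤ.*-identityʳ (↥ q)))
    (cong (λ i → ℤ.suc i ℤ.* ↧ q) (sym (ℤ.div-pos-is-/ℕ (↥ q) _)))
    (ℤ.n<s[n/ℕd]*d (↥ q) _))

  1/1+ : ℕ → ℚ
  1/1+ n = 1/ ℚ.fromℤ (+ suc n)

  0≤1/1+ : ∀ n → 0ℚ ℚ.≤ 1/1+ n
  0≤1/1+ n = *≤* (ℤ.+≤+ z≤n)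

  N²u²≡1 : ∀ q n → q ℚ.* (ℚ.fromℤ (+ suc n) ℚ.* ℚ.fromℤ (+ suc n)) ℚ.* (1/1+ n ℚ.* 1/1+ n) ≡ q
  N²u²≡1 q n = trans (eq q (ℚ.fromℤ (+ suc n)) (1/1+ n))
    (trans (cong (λ o → q ℚ.* (o ℚ.* o)) (ℚ.*-inverseʳ (ℚ.fromℤ (+ suc n))))
      (ℚ.*-identityʳ q))
    where
    eq : ∀ q N u → q ℚ.* (N ℚ.* N) ℚ.* (u ℚ.* u) ≡ q ℚ.* ((N ℚ.* u) ℚ.* (N ℚ.* u))
    eq = solve 3 (λ q N u → q :* (N :* N) :* (u :* u) := q :* ((N :* u) :* (N :* u))) refl
      where open +-*-Solver

  module Approx (q : ℚ) (n : ℕ) where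
    N = ℚ.fromℤ (+ suc n)
    u = 1/1+ n
    Q = (q ℚ.⊔ 0ℚ) ℚ.* (N ℚ.* N)
    f = ℤ.∣ ℚ.floor Q ∣
    k = isqrt f

    0≤u² : 0ℚ ℚ.≤ u ℚ.* u
    0≤u² = *-nonNeg (0≤1/1+ n) (0≤1/1+ n)

    0<u² : 0ℚ ℚ.< u ℚ.* u
    0<u² = *-pos (ℚ.positive⁻¹ u) (ℚ.positive⁻¹ u)

    0≤Q : 0ℚ ℚ.≤ Q
    0≤Q = *-nonNeg (ℚ.p≤q⊔p q 0ℚ) (*-nonNeg {N} {N} (*≤* (ℤ.+≤+ z≤n)) (*≤* (ℤ.+≤+ z≤n)))

    f≡ : + f ≡ ℚ.floor Q
    f≡ = ℤ.0≤i⇒+∣i∣≡i (floor-nonNeg 0≤Q)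

    k²≤Q : ℚ.fromℤ (+ k) ℚ.* ℚ.fromℤ (+ k) ℚ.≤ Q
    k²≤Q = begin
      ℚ.fromℤ (+ k) ℚ.* ℚ.fromℤ (+ k) ≡⟨ fromℤ-* (+ k) (+ k) ⟩
      ℚ.fromℤ (+ k ℤ.* + k)           ≡⟨ cong ℚ.fromℤ (sym (ℤ.pos-* k k)) ⟩
      ℚ.fromℤ (+ (k ℕ.* k))           ≤⟨ fromℤ-≤ (ℤ.+≤+ (isqrt-≤ f)) ⟩
      ℚ.fromℤ (+ f)                   ≡⟨ cong ℚ.fromℤ f≡ ⟩
      ℚ.fromℤ (ℚ.floor Q)             ≤⟨ floor-≤ Q ⟩
      Q                               ∎
      where open ℚ.≤-Reasoning

    Q<[1+k]² : Q ℚ.< (ℚ.fromℤ (+ k) ℚ.+ 1ℚ) ℚ.* (ℚ.fromℤ (+ k) ℚ.+ 1ℚ)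
    Q<[1+k]² = begin-strict
      Q                                         <⟨ floor-> Q ⟩
      ℚ.fromℤ (ℤ.suc (ℚ.floor Q))               ≡⟨ cong (λ i → ℚ.fromℤ (ℤ.suc i)) (sym f≡) ⟩
      ℚ.fromℤ (+ suc f)                         ≤⟨ fromℤ-≤ (ℤ.+≤+ (isqrt-> f)) ⟩
      ℚ.fromℤ (+ (suc k ℕ.* suc k))             ≡⟨ cong ℚ.fromℤ (ℤ.pos-* (suc k) (suc k)) ⟩
      ℚ.fromℤ (+ suc k ℤ.* + suc k)             ≡⟨ sym (fromℤ-* (+ suc k) (+ suc k)) ⟩
      ℚ.fromℤ (+ suc k) ℚ.* ℚ.fromℤ (+ suc k)   ≡⟨ cong (λ a → a ℚ.* a) suck ⟩
      (ℚ.fromℤ (+ k) ℚ.+ 1ℚ) ℚ.* (ℚ.fromℤ (+ k) ℚ.+ 1ℚ) ∎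
      where
      open ℚ.≤-Reasoning
      suck : ℚ.fromℤ (+ suc k) ≡ ℚ.fromℤ (+ k) ℚ.+ 1ℚ
      suck = sym (trans (fromℤ-+ (+ k) (+ 1)) (cong (λ m → ℚ.fromℤ (+ m)) (ℕ.+-comm k 1)))

approx√-nonNeg : ∀ q n → 0ℚ ℚ.≤ approx√ q n
approx√-nonNeg q n = *-nonNeg (fromℤ-≤ {+ 0} {+ Approx.k q n} (ℤ.+≤+ z≤n)) (0≤1/1+ n)

approx√-≤ : ∀ q n → approx√ q n ℚ.* approx√ q n ℚ.≤ q ℚ.⊔ 0ℚ
approx√-≤ q n = begin
  (K ℚ.* u) ℚ.* (K ℚ.* u)  ≡⟨ eq K u ⟩
  (K ℚ.* K) ℚ.* (u ℚ.* u)  ≤⟨ ℚ.*-monoʳ-≤-nonNeg (u ℚ.* u) {{ℚ.nonNegative 0≤u²}} k²≤Q ⟩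
  Q ℚ.* (u ℚ.* u)          ≡⟨ N²u²≡1 (q ℚ.⊔ 0ℚ) n ⟩
  q ℚ.⊔ 0ℚ                 ∎
  where
  open Approx q n
  open ℚ.≤-Reasoning
  K = ℚ.fromℤ (+ k)
  eq : ∀ K u → (K ℚ.* u) ℚ.* (K ℚ.* u) ≡ (K ℚ.* K) ℚ.* (u ℚ.* u)
  eq = solve 2 (λ K u → (K :* u) :* (K :* u) := (K :* K) :* (u :* u)) refl
    where open +-*-Solver

approx√-> : ∀ q n → let s = approx√ q n ℚ.+ 1/ ℚ.fromℤ (+ suc n) in q ℚ.⊔ 0ℚ ℚ.< s ℚ.* s
approx√-> q n = begin-strict
  q ℚ.⊔ 0ℚ                                   ≡⟨ sym (N²u²≡1 (q ℚ.⊔ 0ℚ) n) ⟩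
  Q ℚ.* (u ℚ.* u)                            <⟨ ℚ.*-monoˡ-<-pos (u ℚ.* u) {{ℚ.positive 0<u²}} Q<[1+k]² ⟩
  (K ℚ.+ 1ℚ) ℚ.* (K ℚ.+ 1ℚ) ℚ.* (u ℚ.* u)    ≡⟨ eq K u ⟩
  (K ℚ.* u ℚ.+ u) ℚ.* (K ℚ.* u ℚ.+ u)        ∎
  where
  open Approx q n
  open ℚ.≤-Reasoning
  K = ℚ.fromℤ (+ k)
  eq : ∀ K u → (K ℚ.+ 1ℚ) ℚ.* (K ℚ.+ 1ℚ) ℚ.* (u ℚ.* u) ≡ (K ℚ.* u ℚ.+ u) ℚ.* (K ℚ.* u ℚ.+ u)
  eq = solve 2 (λ K u → (K :+ con 1ℚ) :* (K :+ con 1ℚ) :* (u :* u)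
                          := (K :* u :+ u) :* (K :* u :+ u)) refl
    where open +-*-Solver

private
  archimedean : 0ℚ ℚ.< ε → ∃ λ N → ∀ {n} → N ℕ.≤ n → 1/1+ n ℚ.≤ ε
  archimedean {ε@(ℚ.mkℚ (+ zero) d c)} (*<* (ℤ.+<+ ()))
  archimedean {ε@(ℚ.mkℚ (+ suc a) d c)} _ = d , λ {n} d≤n → *≤* $ ℤ.+≤+ $
    subst (ℕ._≤ suc a ℕ.* suc n) (sym (ℕ.*-identityˡ (suc d)))
      (ℕ.≤-trans (s≤s d≤n) (ℕ.m≤n*m (suc n) (suc a)))
  archimedean {ε@(ℚ.mkℚ (ℤ.-[1+ a ]) d c)} (*<* ())

  square-mono : 0ℚ ℚ.≤ p → p ℚ.≤ q → p ℚ.* p ℚ.≤ q ℚ.* q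
  square-mono {p} {q} 0≤p p≤q = ℚ.≤-trans
    (ℚ.*-monoˡ-≤-nonNeg p {{ℚ.nonNegative 0≤p}} p≤q)
    (ℚ.*-monoʳ-≤-nonNeg q {{ℚ.nonNegative (ℚ.≤-trans 0≤p p≤q)}} p≤q)

  √-step : ∀ {s t u δ} → 0ℚ ℚ.≤ t → 0ℚ ℚ.≤ u → 0ℚ ℚ.< δ → u ℚ.≤ δ →
           s ℚ.* s ℚ.≤ p → q ℚ.< (t ℚ.+ u) ℚ.* (t ℚ.+ u) →
           p ℚ.- q ℚ.< δ ℚ.* δ → s ℚ.- t ℚ.< δ ℚ.+ δ
  √-step {p} {q} {s} {t} {u} {δ} 0≤t 0≤u 0<δ u≤δ s²≤p q<t+u² p-q<δ²
    with (s ℚ.- t) ℚ.<? (δ ℚ.+ δ)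
  ... | yes h = h
  ... | no ¬h = ⊥-elim $ ℚ.<-irrefl refl $ begin-strict
    q ℚ.+ δ ℚ.* δ                            <⟨ ℚ.+-monoˡ-< (δ ℚ.* δ) q<t+u² ⟩
    v ℚ.* v ℚ.+ δ ℚ.* δ                      ≡⟨ sym (ℚ.+-identityʳ _) ⟩
    v ℚ.* v ℚ.+ δ ℚ.* δ ℚ.+ 0ℚ               ≤⟨ ℚ.+-monoʳ-≤ (v ℚ.* v ℚ.+ δ ℚ.* δ) (+-nonNeg 0≤vδ 0≤vδ) ⟩
    v ℚ.* v ℚ.+ δ ℚ.* δ ℚ.+ (v ℚ.* δ ℚ.+ v ℚ.* δ) ≡⟨ eq₁ v δ ⟩
    (v ℚ.+ δ) ℚ.* (v ℚ.+ δ)                  ≤⟨ square-mono (+-nonNeg 0≤v 0≤δ) v+δ≤s ⟩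
    s ℚ.* s                                  ≤⟨ s²≤p ⟩
    p                                        ≡⟨ eq₂ p q ⟩
    q ℚ.+ (p ℚ.- q)                          <⟨ ℚ.+-monoʳ-< q p-q<δ² ⟩
    q ℚ.+ δ ℚ.* δ                            ∎
    where
    open ℚ.≤-Reasoning
    v = t ℚ.+ u
    0≤δ = ℚ.<⇒≤ 0<δ
    0≤v = +-nonNeg 0≤t 0≤u
    0≤vδ = *-nonNeg 0≤v 0≤δ
    open +-*-Solver using (solve; _:+_; _:*_; _:-_; _:=_)
    eq₁ : ∀ v δ → v ℚ.* v ℚ.+ δ ℚ.* δ ℚ.+ (v ℚ.* δ ℚ.+ v ℚ.* δ) ≡ (v ℚ.+ δ) ℚ.* (v ℚ.+ δ)
    eq₁ = solve 2 (λ v δ → v :* v :+ δ :* δ :+ (v :* δ :+ v :* δ) := (v :+ δ) :* (v :+ δ)) refl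
    eq₂ : ∀ p q → p ≡ q ℚ.+ (p ℚ.- q)
    eq₂ = solve 2 (λ p q → p := q :+ (p :- q)) refl
    eq₃ : ∀ t δ → t ℚ.+ δ ℚ.+ δ ≡ (δ ℚ.+ δ) ℚ.+ t
    eq₃ = solve 2 (λ t δ → t :+ δ :+ δ := (δ :+ δ) :+ t) refl
    eq₄ : ∀ s t → s ℚ.- t ℚ.+ t ≡ s
    eq₄ = solve 2 (λ s t → s :- t :+ t := s) refl
    v+δ≤s : v ℚ.+ δ ℚ.≤ s
    v+δ≤s = begin
      t ℚ.+ u ℚ.+ δ    ≤⟨ ℚ.+-monoˡ-≤ δ (ℚ.+-monoʳ-≤ t u≤δ) ⟩
      t ℚ.+ δ ℚ.+ δ    ≡⟨ eq₃ t δ ⟩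
      (δ ℚ.+ δ) ℚ.+ t  ≤⟨ ℚ.+-monoˡ-≤ t (ℚ.≮⇒≥ ¬h) ⟩
      s ℚ.- t ℚ.+ t    ≡⟨ eq₄ s t ⟩
      s                ∎

infix 9 √_

√_ : ℝ → ℝ
√ x = mkℝ (λ n → approx√ (seq x n) n) √-cauchy
  where
  x⁺ = x ⊔ fromℚ 0ℚ
  √-cauchy : IsCauchy (λ n → approx√ (seq x n) n)
  √-cauchy {ε} 0<ε =
    let δ       = ½ ℚ.* ε
        0<δ     = *-pos 0<½ 0<ε
        M , x-c = cauchy x⁺ (*-pos 0<δ 0<δ)
        N , u≤  = archimedean 0<δ
        step : ∀ {m n} → M ℕ.⊔ N ℕ.≤ m → M ℕ.⊔ N ℕ.≤ n →
               approx√ (seq x m) m ℚ.- approx√ (seq x n) n ℚ.< δ ℚ.+ δ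
        step {m} {n} ≤m ≤n = √-step
          {s = approx√ (seq x m) m}
          (approx√-nonNeg (seq x n) n) (0≤1/1+ n) 0<δ (u≤ (⊔ʳ M N ≤n))
          (approx√-≤ (seq x m) m) (approx√-> (seq x n) n)
          (ℚ.≤-<-trans (p≤∣p∣ _)
            (x-c (⊔ˡ M N ≤m) (⊔ˡ M N ≤n)))
    in M ℕ.⊔ N , λ {m} {n} ≤m ≤n → subst (_ ℚ.<_) (½+½ ε) $
         ∣p∣<ε (step ≤m ≤n)
           (subst (ℚ._< _) (p-q≡-[q-p] (approx√ (seq x n) n) (approx√ (seq x m) m))
             (step ≤n ≤m))

√-nonNeg : ∀ x → fromℚ 0ℚ ≤ √ x
√-nonNeg x (ε , 0<ε , N , s+ε<0) = ℚ.<-irrefl refl $ ℚ.<-trans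
  (ℚ.+-mono-≤-< (approx√-nonNeg (seq x N) N) 0<ε)
  (s+ε<0 (ℕ.≤-refl {N}))

√-square : ∀ x → √ x * √ x ≃ x ⊔ fromℚ 0ℚ
√-square x {ε} 0<ε =
  let A , 0<A , M , s<A = bounded (√ x)
      B       = A ℚ.+ A ℚ.+ 1ℚ
      0<B     = ℚ.+-mono-< (ℚ.+-mono-< 0<A 0<A) 0<1
      instance
        B-pos = ℚ.positive 0<B
        B≢0   = ℚ.pos⇒nonZero B
      δ       = ε ℚ.* 1/ B
      0<δ     = *-pos 0<ε (ℚ.positive⁻¹ (1/ B) {{ℚ.1/pos⇒pos B}})
      δB≡ε    = trans (ℚ.*-assoc ε (1/ B) B)
                  (trans (cong (ε ℚ.*_) (ℚ.*-inverseˡ B)) (ℚ.*-identityʳ ε))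
      N , u≤δ = archimedean 0<δ
  in M ℕ.⊔ N , λ {n} ≤n → let
       q  = seq x n ℚ.⊔ 0ℚ
       s  = approx√ (seq x n) n
       u  = 1/1+ n
       s≤A = ℚ.<⇒≤ (ℚ.≤-<-trans (p≤∣p∣ s) (s<A (⊔ˡ M N ≤n)))
       open ℚ.≤-Reasoning
     in ∣p∣<ε
       (begin-strict
         s ℚ.* s ℚ.- q      ≤⟨ ℚ.+-monoˡ-≤ (ℚ.- q) (approx√-≤ (seq x n) n) ⟩
         q ℚ.- q            ≡⟨ ℚ.+-inverseʳ q ⟩
         0ℚ                 <⟨ 0<ε ⟩
         ε                  ∎)
       (begin-strict
         ℚ.- (s ℚ.* s ℚ.- q)                    ≡⟨ sym (p-q≡-[q-p] q (s ℚ.* s)) ⟩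
         q ℚ.- s ℚ.* s                          <⟨ ℚ.+-monoˡ-< (ℚ.- (s ℚ.* s)) (approx√-> (seq x n) n) ⟩
         (s ℚ.+ u) ℚ.* (s ℚ.+ u) ℚ.- s ℚ.* s    ≡⟨ eq s u ⟩
         u ℚ.* (s ℚ.+ s ℚ.+ u)                  ≤⟨ ℚ.*-monoˡ-≤-nonNeg u {{ℚ.nonNegative (0≤1/1+ n)}}
                                                    (ℚ.+-mono-≤ (ℚ.+-mono-≤ s≤A s≤A) (u≤1 n)) ⟩
         u ℚ.* B                                ≤⟨ ℚ.*-monoʳ-≤-nonNeg B {{ℚ.nonNegative (ℚ.<⇒≤ 0<B)}}
                                                    (u≤δ (⊔ʳ M N ≤n)) ⟩
         δ ℚ.* B                                ≡⟨ δB≡ε ⟩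
         ε                                      ∎)
  where
  u≤1 : ∀ n → 1/1+ n ℚ.≤ 1ℚ
  u≤1 n = *≤* (ℤ.+≤+ (s≤s z≤n))
  eq : ∀ s u → (s ℚ.+ u) ℚ.* (s ℚ.+ u) ℚ.- s ℚ.* s ≡ u ℚ.* (s ℚ.+ s ℚ.+ u)
  eq = solve 2 (λ s u → (s :+ u) :* (s :+ u) :- s :* s := u :* (s :+ s :+ u)) refl
    where open +-*-Solver

-- The floor of a real number is not computable, so ⌊_⌋ and τ are given by
-- their graphs.
⌊_⌋≡_ : ℝ → ℤ → Set
⌊ x ⌋≡ k = fromℤ k ≤ x × x < fromℤ (ℤ.suc k)

τ : ℝ × ℝ → Rel (ℤ × ℤ) 0ℓ
τ (r₀ , r₁) (a₀ , a₁) (b₀ , b₁) =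
  b₀ ≡ a₁ × ∃ λ k → (⌊ r₀ * fromℤ a₀ + r₁ * fromℤ a₁ ⌋≡ k) × b₁ ≡ ℤ.- k

IsOrbit : ℝ × ℝ → Pred (ℕ → ℤ) 0ℓ
IsOrbit r a = ∀ n → τ r (a n , a (1 ℕ.+ n)) (a (1 ℕ.+ n) , a (2 ℕ.+ n))

UltimatelyPeriodic : Pred (ℕ → ℤ) 0ℓ
UltimatelyPeriodic a =
  ∃ λ n₀ → ∃ λ p → 0 ℕ.< p × (∀ n → n₀ ℕ.≤ n → a (n ℕ.+ p) ≡ a n)

EndsInTrivialCycle : Pred (ℕ → ℤ) 0ℓ
EndsInTrivialCycle a = ∃ λ n₀ → ∀ n → n₀ ℕ.≤ n → a n ≡ + 0

D₂⁽*⁾ : Pred (ℝ × ℝ) 0ℓ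
D₂⁽*⁾ r = ∀ a → IsOrbit r a → UltimatelyPeriodic a → EndsInTrivialCycle a

open import Agda.Builtin.FromNat using (Number; fromNat)
open import Data.Unit using (⊤)
import Data.Nat.Literals as ℕ

instance
  ℕ-number : Number ℕ
  ℕ-number = ℕ.number

  ℝ-number : Number ℝ
  ℝ-number = record
    { Constraint = λ _ → ⊤
    ; fromNat    = λ n → fromℤ (+ n)
    }

E₁ E₂ E₃ E₄ E₅ E₆ E₇ E₈ E₉ E₁₀ : Pred (ℝ × ℝ) 0ℓ

E₁ (r₀ , r₁) = - 2 < r₀ + r₁ × r₀ + r₁ < 0

E₂ (r₀ , r₁) = r₁ ≃ r₀ + 1

E₃ (r₀ , r₁) = (- 2 < r₀ × r₀ ≤ - 1) × (- 1 < r₁ × r₁ ≤ 0)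

E₄ (r₀ , r₁) = (- 1 ≤ r₀ × r₀ < 0) × (0 ≤ r₁ × r₁ < 1)

E₅ (r₀ , r₁) = 0 < r₀ × r₁ ≤ - 2 * √ r₀ × 0 ≤ r₀ + r₁

E₆ (r₀ , r₁) = (r₀ + r₁ ≤ - 2 × ¬ (r₀ - r₁ ≃ - 1)) × ¬ (- 2 < r₀ × - 1 < r₁)

E₇ (r₀ , r₁) = 0 ≤ r₀ + r₁ × r₀ < 0 × 1 ≤ r₁

E₈ (r₀ , r₁) = r₀ - r₁ < - 1 × 0 ≤ r₀

E₉ (r₀ , r₁) =
  - fromℚ ½ < r₀ - r₁ × (- 2 * √ r₀) ⊔ (- r₀) ≤ r₁ × fromℚ (+ 3 ℚ./ 2) + √ 2 < r₀

E₁₀ (r₀ , r₁) =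
  (- 1 < r₀ - r₁ × r₀ - r₁ ≤ - fromℚ ½) × 1 + √ 5 ≤ r₁ × 4 * r₀ ≤ r₁ * r₁

𝓡 : Pred (ℝ × ℝ) 0ℓ
𝓡 = ∁ (E₁ ∪ E₂ ∪ E₃ ∪ E₄ ∪ E₅ ∪ E₆ ∪ E₇ ∪ E₈ ∪ E₉ ∪ E₁₀)

{-# OPTIONS --safe #-}
module Submission where

-- Put δ = x + 1 − y for r = (x , y).  An orbit satisfies fₙ ∈ [0 , 1) for
-- fₙ = x aₙ + y aₙ₊₁ + aₙ₊₂, and the hypotheses give 4/3 ≤ x ≤ 7/2, δ > 0 and x + y ≥ 0.
-- Let M > 0 be the maximum of |aₙ| over a non-trivial cycle.
--   * If δ ≥ 1/16, then M ≤ 12: the recurrence is expanding, so a truncation of the power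
--     series of 1 / (x + y z + z²), with rational coefficients depending only on a small
--     box containing (x , δ), combines the fₙ into a bound for |aₙ|.
--   * If δ ≤ 1/16, then M ≤ 16: (−1)ⁿ aₙ decreases faster and faster after its maximum,
--     until it falls below −M.
--   * For each remaining M, an orbit is followed from a position where |aₙ| = M.  Every new
--     term confines (x , δ) to a strip, and after a few steps no parameters are left.
-- Only finitely many linear inequalities with integer coefficients in x and δ are used;
-- the reals enter through the cone of the integral linear forms that are nonnegative.

open import Data.Bool using (Bool; true; false; if_then_else_; _∧_; _∨_; T)
open import Data.Bool.ListAction using (all; any)
open import Data.Bool.Properties using (T-∧; T-∨; T-≡)
open import Data.Empty using (⊥; ⊥-elim)
open import Data.Integer as ℤ using (ℤ; +_; -[1+_]; ∣_∣)
import Data.Integer.Properties as ℤ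
open import Data.List using (List; []; _∷_; _++_; map; upTo)
open import Data.List.Membership.Propositional using (_∈_)
open import Data.List.Membership.Propositional.Properties using (∈-map⁺; ∈-upTo⁺; ∈-++⁺ˡ; ∈-++⁺ʳ)
open import Data.List.Relation.Unary.All as All using (All)
open import Data.List.Relation.Unary.All.Properties using (all⁺)
open import Data.Maybe using (Maybe; just; nothing)
open import Data.Nat as ℕ using (ℕ; zero; suc; z≤n; s≤s)
import Data.Nat.Properties as ℕ
open import Data.Product using (∃; _×_; _,_; proj₁; proj₂)
open import Data.Sum using (_⊎_; inj₁; inj₂; [_,_]′)
open import Data.Unit using (tt)
open import Function using (_∘_; _$_; Equivalence)
open import Relation.Binary.PropositionalEquality
open import Relation.Nullary using (¬_; yes; no)

-- The roots of z² + y z + x lie outside the closed unit disc: their product x exceeds 1, and the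
-- values at -1 and 1 are δ > 0 and x + y + 1 > 0. Hence the power series of 1 / (x + y z + z²) is
-- absolutely summable and bounds aₙ through the fₙ. As δ tends to 0, one root tends to -1 and this
-- bound grows without limit; at δ = 0 the alternating sequences are genuine cycles. That is why a
-- strip along δ = 0 needs an argument of its own, and why δ replaces y as a coordinate. Multipliers
-- with fixed rational values work only for nearby parameters, so the rest of the region is bisected
-- into boxes. The order of the reals is undecidable, hence nothing is ever computed from x and y.
-- All evaluation concerns integer certificates, and case distinctions on the parameters occur only
-- on the way to a contradiction.

module BoundedOrbits where
  open import Data.Integer.Tactic.RingSolver using (solve-∀; solve)
  open import Data.Integer using (_+_; _*_; _-_; -_)

  -- Integral linear forms in the parameters

  -- The form ⟨ a , b , c ⟩ stands for the real number a x + b δ + c, where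
  -- (x , y) = r and δ = x + 1 − y.
  record Form : Set where
    constructor ⟨_,_,_⟩
    field
      coeff-x coeff-δ coeff-1 : ℤ

  open Form

  infixl 6 _⊕_
  infixl 7 _⊙_
  infix  8 ⊝_

  _⊕_ : Form → Form → Form
  ⟨ a , b , c ⟩ ⊕ ⟨ a′ , b′ , c′ ⟩ = ⟨ a + a′ , b + b′ , c + c′ ⟩

  _⊙_ : ℤ → Form → Form
  k ⊙ ⟨ a , b , c ⟩ = ⟨ k * a , k * b , k * c ⟩

  ⊝_ : Form → Form
  ⊝ ⟨ a , b , c ⟩ = ⟨ - a , - b , - c ⟩

  const : ℤ → Form
  const c = ⟨ + 0 , + 0 , c ⟩

  form-≡ : ∀ {a b c a′ b′ c′} → a ≡ a′ → b ≡ b′ → c ≡ c′ → ⟨ a , b , c ⟩ ≡ ⟨ a′ , b′ , c′ ⟩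
  form-≡ refl refl refl = refl

  ⊝-involutive : ∀ u → ⊝ ⊝ u ≡ u
  ⊝-involutive ⟨ a , b , c ⟩ =
    form-≡ (ℤ.neg-involutive a) (ℤ.neg-involutive b) (ℤ.neg-involutive c)

  ⊙-⊝ : ∀ k u → ⊝ (k ⊙ u) ≡ k ⊙ ⊝ u
  ⊙-⊝ k ⟨ a , b , c ⟩ =
    form-≡ (ℤ.neg-distribʳ-* k a) (ℤ.neg-distribʳ-* k b) (ℤ.neg-distribʳ-* k c)

  ⊕-inverse-unique : ∀ u v → u ⊕ v ≡ const (+ 0) → v ≡ ⊝ u
  ⊕-inverse-unique ⟨ a , b , c ⟩ ⟨ a′ , b′ , c′ ⟩ eq = form-≡
    (unique a a′ (cong coeff-x eq)) (unique b b′ (cong coeff-δ eq)) (unique c c′ (cong coeff-1 eq))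
    where
    unique : ∀ i j → i + j ≡ + 0 → j ≡ - i
    unique i j eq = trans (identity i j) (trans (cong (λ k → - i + k) eq) (ℤ.+-identityʳ (- i)))
      where
      identity : ∀ i j → j ≡ - i + (i + j)
      identity = solve-∀

  record IsCone (NonNeg : Form → Set) : Set where
    field
      +-closed     : ∀ {u v} → NonNeg u → NonNeg v → NonNeg (u ⊕ v)
      *-closed     : ∀ k {u} → NonNeg u → NonNeg (+ k ⊙ u)
      *-cancel     : ∀ k {u} → NonNeg (+ suc k ⊙ u) → NonNeg u
      total        : ∀ {u} → ¬ NonNeg u → NonNeg (⊝ u)
      const-nonNeg : ∀ n → NonNeg (const (+ n))
      const-neg    : ∀ n → ¬ NonNeg (const -[1+ n ])

    scale : ∀ {k u} → + 0 ℤ.≤ k → NonNeg u → NonNeg (k ⊙ u)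
    scale {+ k} _ = *-closed k

    const⁻ : ∀ {i} → NonNeg (const i) → + 0 ℤ.≤ i
    const⁻ {+ n}      _   = ℤ.+≤+ z≤n
    const⁻ { -[1+ n ]} neg = ⊥-elim (const-neg n neg)

    const⁺ : ∀ {i} → + 0 ℤ.≤ i → NonNeg (const i)
    const⁺ {+ n} _ = const-nonNeg n

    -- The sign of a real number cannot be decided, but towards ⊥ the split is admissible: refuting
    -- one sign yields the other by `total`.
    by-cases : ∀ u → (NonNeg u → ⊥) → (NonNeg (⊝ u) → ⊥) → ⊥
    by-cases u left right = left (subst NonNeg (⊝-involutive u) (total right))

  -- Polygons of parameters and the exhaustive search

  -- A constraint (u , s) says u ≥ 0 if s is false and u > 0 if s is true.
  Constraint : Set
  Constraint = Form × Bool

  wedge : Form → Form → ℤ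
  wedge ⟨ a , b , _ ⟩ ⟨ a′ , b′ , _ ⟩ = a * b′ - b * a′

  _×ᶠ_ : Form → Form → Form
  ⟨ a , b , c ⟩ ×ᶠ ⟨ a′ , b′ , c′ ⟩ = ⟨ b * c′ - c * b′ , c * a′ - a * c′ , a * b′ - b * a′ ⟩

  dot : Form → Form → ℤ
  dot ⟨ a , b , c ⟩ ⟨ a′ , b′ , c′ ⟩ = a * a′ + b * b′ + c * c′

  isNonNeg isPos : ℤ → Bool
  isNonNeg (+ _)    = true
  isNonNeg -[1+ _ ] = false
  isPos (+ suc _) = true
  isPos _         = false

  belowZero : ℤ → Bool → Bool
  belowZero -[1+ _ ]  _ = true
  belowZero (+ zero)  s = s
  belowZero (+ suc _) _ = false

  -- Meant for multipliers that eliminate x and δ. Then a negative constant refutes the three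
  -- constraints, and so does 0 as soon as a strict constraint has positive weight.
  contradicts : ℤ → ℤ → ℤ → Constraint → Constraint → Constraint → Bool
  contradicts (+ k) (+ l) (+ m) (u , s) (v , t) (w , r) =
    belowZero (+ k * coeff-1 u + (+ l * coeff-1 v + + m * coeff-1 w))
              (s ∧ isPos (+ k) ∨ (t ∧ isPos (+ l) ∨ r ∧ isPos (+ m)))
  contradicts _ _ _ _ _ _ = false

  -- The minors are determined up to a common sign, which depends on the orientation of the three
  -- normals.
  contradicts± : ℤ → ℤ → ℤ → Constraint → Constraint → Constraint → Bool
  contradicts± k l m u v w = contradicts k l m u v w ∨ contradicts (- k) (- l) (- m) u v w

  -- Farkas' lemma for three half planes: by Cramer's rule the only candidates for a
  -- combination without x and δ have the 2 × 2 minors as multipliers.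
  incompatible : Constraint → Constraint → Constraint → Bool
  incompatible u@(u′ , _) v@(v′ , _) w@(w′ , _) =
    contradicts± (wedge v′ w′) (wedge w′ u′) (wedge u′ v′) u v w

  -- By Helly's theorem an infeasible family of half planes contains three infeasible ones. If the
  -- list itself is feasible, u is among them, so only pairs from the list are tried.
  infeasible : Constraint → List Constraint → Bool
  infeasible u []       = false
  infeasible u (v ∷ vs) = any (incompatible u v) vs ∨ infeasible u vs

  -- A convex polygon given by its edges in counterclockwise order; the i-th vertex
  -- is the intersection of the edges i and i + 1 in homogeneous coordinates.  The list
  -- of vertices is empty for degenerate polygons.  The vertices only guide the search.
  record Polygon : Set where
    constructor polygon
    field
      edges    : List Constraint
      vertices : List Form

  open Polygon

  intersections : Constraint → Constraint → List Constraint → List Form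
  intersections (e₀ , _) (e , _) []               = e ×ᶠ e₀ ∷ []
  intersections e₀ (e , _) (e′@(f , _) ∷ es) = e ×ᶠ f ∷ intersections e₀ e′ es

  fromEdges : List Constraint → Polygon
  fromEdges []           = polygon [] []
  fromEdges es@(e ∷ es′) = polygon es (intersections e e es′)

  last : ℤ → List ℤ → ℤ
  last s []       = s
  last _ (s ∷ ss) = last s ss

  -- The edge e runs from the vertex where u has the value s to the one where it has the value t.
  -- The new edge enters where u stops being positive. As the boundary is closed, the first edge
  -- starts at the last vertex.
  clip : Constraint → ℤ → List ℤ → List Constraint → List Constraint
  clip u s (t ∷ ts) (e ∷ es) with isPos s | isPos t
  ... | true  | true  = e ∷ clip u t ts es
  ... | true  | false = e ∷ u ∷ clip u t ts es
  ... | false | true  = e ∷ clip u t ts es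
  ... | false | false = clip u t ts es
  clip _ _ _ _ = []

  -- If u is positive at no vertex, at most a boundary piece survives, and strictness decides
  -- whether anything does. Such a remainder loses its vertices, which sends every later cut to the
  -- test by `infeasible`.
  cut : Constraint → Polygon → List ℤ → Maybe Polygon
  cut u P ss =
    if any isPos ss
    then (if all isNonNeg ss then just P else just (fromEdges (clip u (last (+ 0) ss) ss (edges P))))
    else (if infeasible u (edges P) then nothing else just (polygon (u ∷ edges P) []))

  _∩ᶠ_ : Constraint → Polygon → Maybe Polygon
  u ∩ᶠ P = cut u P (map (dot (proj₁ u)) (vertices P))

  emptyOr : (Polygon → Bool) → Maybe Polygon → Bool
  emptyOr f nothing  = true
  emptyOr f (just P) = f P

  -- r₀ p + r₁ q + r as a form.
  next : ℤ → ℤ → ℤ → Form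
  next p q r = ⟨ p + q , - q , q + r ⟩

  integersUpTo : ℕ → List ℤ
  integersUpTo m = map +_ (upTo (suc m)) ++ map -[1+_] (upTo m)

  -- If true, no orbit with parameters in P continues p , q within rs for k steps.
  escapes : ℕ → List ℤ → Polygon → ℤ → ℤ → Bool
  escapes zero    _  _ _ _ = false
  escapes (suc k) rs P p q = all (λ r →
    emptyOr (λ P′ → emptyOr (λ P″ → escapes k rs P″ q r)
      ((const (+ 1) ⊕ ⊝ next p q r , true) ∩ᶠ P′))
      ((next p q r , false) ∩ᶠ P)) rs

  startEscapes : List Constraint → ℕ → ℤ → Bool
  startEscapes es m q = escapes 12 (integersUpTo m) (fromEdges es) (+ m) q ∧
                        escapes 12 (integersUpTo m) (fromEdges es) (- + m) q

  -- Opaque, as the type checker must not unfold the search outside of its evaluation.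
  opaque
    allEscape : List Constraint → ℕ → Bool
    allEscape es m = all (startEscapes es m) (integersUpTo m)

    allEscape⇒startEscapes : ∀ es m → T (allEscape es m) →
                             ∀ {q} → q ∈ integersUpTo m → T (startEscapes es m q)
    allEscape⇒startEscapes es m c = All.lookup (all⁺ (startEscapes es m) (integersUpTo m) c)

  all-lookup : ∀ {A : Set} (p : A → Bool) xs → all p xs ≡ true → ∀ {x} → x ∈ xs → T (p x)
  all-lookup p xs eq = All.lookup (all⁺ p xs (Equivalence.from T-≡ eq))

  ∈-integersUpTo : ∀ {m} r → ∣ r ∣ ℕ.≤ m → r ∈ integersUpTo m
  ∈-integersUpTo     (+ n)    n≤m = ∈-++⁺ˡ (∈-map⁺ +_ (∈-upTo⁺ (s≤s n≤m)))
  ∈-integersUpTo {m} -[1+ n ] n<m = ∈-++⁺ʳ (map +_ (upTo (suc m))) (∈-map⁺ -[1+_] (∈-upTo⁺ n<m))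

  -- Soundness of the search

  IsOrbitOf : (Form → Set) → (ℕ → ℤ) → Set
  IsOrbitOf NonNeg a = ∀ n → let f = next (a n) (a (1 ℕ.+ n)) (a (2 ℕ.+ n)) in
    NonNeg f × ¬ NonNeg (⊝ (const (+ 1) ⊕ ⊝ f))

  module Search {NonNeg : Form → Set} (isCone : IsCone NonNeg) where
    open IsCone isCone

    Holds : Constraint → Set
    Holds (u , false) = NonNeg u
    Holds (u , true)  = ¬ NonNeg (⊝ u)

    weaken : ∀ {u} s → Holds (u , s) → NonNeg u
    weaken     false h = h
    weaken {u} true  h = subst NonNeg (⊝-involutive u) (total h)

    -- From k u + v = 0 with k > 0 follows -k u = v ≥ 0, hence -u ≥ 0, against u > 0.
    strict-sum : ∀ {u v} s k → T (s ∧ isPos (+ k)) → Holds (u , s) → NonNeg v →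
                 + k ⊙ u ⊕ v ≡ const (+ 0) → ⊥
    strict-sum {u} {v} true (suc k) _ hu hv eq = hu $ *-cancel k $
      subst NonNeg (trans (⊕-inverse-unique (+ suc k ⊙ u) v eq) (⊙-⊝ (+ suc k) u)) hv

    ⊕-left-comm : ∀ u v w → v ⊕ (u ⊕ w) ≡ u ⊕ (v ⊕ w)
    ⊕-left-comm ⟨ a , b , c ⟩ ⟨ a′ , b′ , c′ ⟩ ⟨ a″ , b″ , c″ ⟩ =
      form-≡ (comm a a′ a″) (comm b b′ b″) (comm c c′ c″)
      where
      comm : ∀ i j k → j + (i + k) ≡ i + (j + k)
      comm = solve-∀

    ⊕-rotate : ∀ u v w → w ⊕ (u ⊕ v) ≡ u ⊕ (v ⊕ w)
    ⊕-rotate ⟨ a , b , c ⟩ ⟨ a′ , b′ , c′ ⟩ ⟨ a″ , b″ , c″ ⟩ =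
      form-≡ (comm a a′ a″) (comm b b′ b″) (comm c c′ c″)
      where
      comm : ∀ i j k → k + (i + j) ≡ i + (j + k)
      comm = solve-∀

    contradicts-sound : ∀ k l m {u v w} → (let Σ = k ⊙ proj₁ u ⊕ (l ⊙ proj₁ v ⊕ m ⊙ proj₁ w)) →
      coeff-x Σ ≡ + 0 → coeff-δ Σ ≡ + 0 → T (contradicts k l m u v w) →
      Holds u → Holds v → Holds w → ⊥
    contradicts-sound (+ k) (+ l) (+ m) {u , s} {v , t} {w , r} x≡0 δ≡0 c hu hv hw =
      conclude (coeff-1 Σ) refl c
      where
      Σ = + k ⊙ u ⊕ (+ l ⊙ v ⊕ + m ⊙ w)
      ku = *-closed k (weaken s hu)
      lv = *-closed l (weaken t hv)
      mw = *-closed m (weaken r hw)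
      Σ≡ : ∀ {i} → coeff-1 Σ ≡ i → Σ ≡ const i
      Σ≡ = form-≡ x≡0 δ≡0
      conclude : ∀ i → coeff-1 Σ ≡ i →
                 T (belowZero i (s ∧ isPos (+ k) ∨ (t ∧ isPos (+ l) ∨ r ∧ isPos (+ m)))) → ⊥
      conclude -[1+ n ] eq _ = const-neg n (subst NonNeg (Σ≡ eq) (+-closed ku (+-closed lv mw)))
      conclude (+ zero) eq c with Equivalence.to (T-∨ {s ∧ isPos (+ k)}) c
      ... | inj₁ su = strict-sum s k su hu (+-closed lv mw) (Σ≡ eq)
      ... | inj₂ c′ with Equivalence.to (T-∨ {t ∧ isPos (+ l)}) c′
      ... | inj₁ sv = strict-sum t l sv hv (+-closed ku mw)
                        (trans (⊕-left-comm (+ k ⊙ u) (+ l ⊙ v) (+ m ⊙ w)) (Σ≡ eq))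
      ... | inj₂ sw = strict-sum r m sw hw (+-closed ku lv)
                        (trans (⊕-rotate (+ k ⊙ u) (+ l ⊙ v) (+ m ⊙ w)) (Σ≡ eq))

    contradicts±-sound : ∀ k l m {u v w} → (let Σ = k ⊙ proj₁ u ⊕ (l ⊙ proj₁ v ⊕ m ⊙ proj₁ w)) →
      coeff-x Σ ≡ + 0 → coeff-δ Σ ≡ + 0 → T (contradicts± k l m u v w) →
      Holds u → Holds v → Holds w → ⊥
    contradicts±-sound k l m {u} {v} {w} x≡0 δ≡0 c with Equivalence.to (T-∨ {contradicts k l m u v w}) c
    ... | inj₁ c⁺ = contradicts-sound k l m {u} {v} {w} x≡0 δ≡0 c⁺
    ... | inj₂ c⁻ = contradicts-sound (- k) (- l) (- m) {u} {v} {w}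
      (trans (negate k l m (coeff-x (proj₁ u)) (coeff-x (proj₁ v)) (coeff-x (proj₁ w))) (cong -_ x≡0))
      (trans (negate k l m (coeff-δ (proj₁ u)) (coeff-δ (proj₁ v)) (coeff-δ (proj₁ w))) (cong -_ δ≡0)) c⁻
      where
      negate : ∀ k l m a b c → - k * a + (- l * b + - m * c) ≡ - (k * a + (l * b + m * c))
      negate = solve-∀

    incompatible-sound : ∀ u v w → T (incompatible u v w) → Holds u → Holds v → Holds w → ⊥
    incompatible-sound u@(⟨ a , b , _ ⟩ , _) v@(⟨ a′ , b′ , _ ⟩ , _) w@(⟨ a″ , b″ , _ ⟩ , _) =
      contradicts±-sound
        (wedge (proj₁ v) (proj₁ w)) (wedge (proj₁ w) (proj₁ u)) (wedge (proj₁ u) (proj₁ v))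
        {u} {v} {w} (cramer-x a b a′ b′ a″ b″) (cramer-δ a b a′ b′ a″ b″)
      where
      cramer-x : ∀ a b a′ b′ a″ b″ →
        (a′ * b″ - b′ * a″) * a + ((a″ * b - b″ * a) * a′ + (a * b′ - b * a′) * a″) ≡ + 0
      cramer-x = solve-∀
      cramer-δ : ∀ a b a′ b′ a″ b″ →
        (a′ * b″ - b′ * a″) * b + ((a″ * b - b″ * a) * b′ + (a * b′ - b * a′) * b″) ≡ + 0
      cramer-δ = solve-∀

    any-incompatible-sound : ∀ u v ws → T (any (incompatible u v) ws) →
                             Holds u → Holds v → All Holds ws → ⊥
    any-incompatible-sound u v (w ∷ ws) i hu hv (hw All.∷ hws)
      with Equivalence.to (T-∨ {incompatible u v w}) i
    ... | inj₁ i′ = incompatible-sound u v w i′ hu hv hw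
    ... | inj₂ i′ = any-incompatible-sound u v ws i′ hu hv hws

    infeasible-sound : ∀ u vs → T (infeasible u vs) → Holds u → All Holds vs → ⊥
    infeasible-sound u (v ∷ vs) i hu (hv All.∷ hvs)
      with Equivalence.to (T-∨ {any (incompatible u v) vs}) i
    ... | inj₁ i′ = any-incompatible-sound u v vs i′ hu hv hvs
    ... | inj₂ i′ = infeasible-sound u vs i′ hu hvs

    clip-holds : ∀ u s ts es → Holds u → All Holds es → All Holds (clip u s ts es)
    clip-holds u s []       es       hu hes = All.[]
    clip-holds u s (t ∷ ts) []       hu hes = All.[]
    clip-holds u s (t ∷ ts) (e ∷ es) hu (he All.∷ hes) with isPos s | isPos t
    ... | true  | true  = he All.∷ clip-holds u t ts es hu hes
    ... | true  | false = he All.∷ hu All.∷ clip-holds u t ts es hu hes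
    ... | false | true  = he All.∷ clip-holds u t ts es hu hes
    ... | false | false = clip-holds u t ts es hu hes

    Satisfies : Polygon → Set
    Satisfies P = All Holds (edges P)

    fromEdges-holds : ∀ {es} → All Holds es → Satisfies (fromEdges es)
    fromEdges-holds All.[]         = All.[]
    fromEdges-holds (he All.∷ hes) = he All.∷ hes

    -- Whatever the values `ss` at the vertices are, `cut` only drops constraints or adds u, and it
    -- reports emptiness only on a Farkas certificate. So nothing has to be proved about vertices.
    cut-sound : ∀ {f u P} ss → Holds u → Satisfies P → (∀ {P′} → Satisfies P′ → ¬ T (f P′)) →
                ¬ T (emptyOr f (cut u P ss))
    cut-sound {u = u} {P} ss hu hP sound c with any isPos ss
    ... | true with all isNonNeg ss
    ...   | true  = sound hP c
    ...   | false = sound (fromEdges-holds (clip-holds u (last (+ 0) ss) ss (edges P) hu hP)) c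
    cut-sound {u = u} {P} ss hu hP sound c | false with infeasible u (edges P) in eq
    ...   | true  = infeasible-sound u (edges P) (Equivalence.from T-≡ eq) hu hP
    ...   | false = sound (hu All.∷ hP) c

    module _ {a : ℕ → ℤ} (isOrbit : IsOrbitOf NonNeg a)
             {m} (bounded : ∀ n → ∣ a n ∣ ℕ.≤ m) where

      escapes-sound : ∀ k P → Satisfies P → ∀ n → ¬ T (escapes k (integersUpTo m) P (a n) (a (1 ℕ.+ n)))
      escapes-sound zero    P hP n ()
      escapes-sound (suc k) P hP n c =
        cut-sound (map (dot f) (vertices P)) (proj₁ (isOrbit n)) hP
          (λ {P′} hP′ → cut-sound (map (dot (const (+ 1) ⊕ ⊝ f)) (vertices P′))
            (proj₂ (isOrbit n)) hP′ λ {P″} hP″ → escapes-sound k P″ hP″ (1 ℕ.+ n))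
          (All.lookup (all⁺ _ (integersUpTo m) c)
            (∈-integersUpTo (a (2 ℕ.+ n)) (bounded (2 ℕ.+ n))))
        where f = next (a n) (a (1 ℕ.+ n)) (a (2 ℕ.+ n))

      allEscape-sound : ∀ {es} → All Holds es → T (allEscape es m) → ∀ n → ¬ ∣ a n ∣ ≡ m
      allEscape-sound {es} hes c n refl = split (a n) refl
        where
        starts = Equivalence.to T-∧ (allEscape⇒startEscapes es m c
                   (∈-integersUpTo (a (1 ℕ.+ n)) (bounded (1 ℕ.+ n))))
        contra : ∀ i → a n ≡ i → ¬ T (escapes 12 (integersUpTo m) (fromEdges es) i (a (1 ℕ.+ n)))
        contra i refl = escapes-sound 12 (fromEdges es) (fromEdges-holds hes) n
        split : ∀ i → a n ≡ i → ⊥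
        split (+ k)    eq = contra _ (trans eq (cong (+_ ∘ ∣_∣) (sym eq))) (proj₁ starts)
        split -[1+ k ] eq = contra _ (trans eq (cong (-_ ∘ +_ ∘ ∣_∣) (sym eq))) (proj₂ starts)

  -- Amplitude bounds on boxes of parameters

  -- The rectangle x₀ ≤ d x ≤ x₁, e₀ ≤ d δ ≤ e₁.
  record Box : Set where
    constructor box
    field
      d x₀ x₁ e₀ e₁ : ℕ

  -- ℤ._⊔_ computes in unary.
  max : ℤ → ℤ → ℤ
  max i j = if isNonNeg (j - i) then j else i

  i≤max : ∀ i j → i ℤ.≤ max i j
  i≤max i j with j - i in eq
  ... | + n     = ℤ.0≤i-j⇒j≤i (subst (+ 0 ℤ.≤_) (sym eq) (ℤ.+≤+ z≤n))
  ... | -[1+ n ] = ℤ.≤-refl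

  j≤max : ∀ i j → j ℤ.≤ max i j
  j≤max i j with j - i in eq
  ... | + n     = ℤ.≤-refl
  ... | -[1+ n ] = ℤ.≮⇒≥ λ i<j → ℤ.<⇒≱ ℤ.-<+ (subst (+ 0 ℤ.≤_) eq (ℤ.i≤j⇒0≤j-i (ℤ.<⇒≤ i<j)))

  module _ (B : Box) where
    open Box B

    maxTerm : ℤ → ℕ → ℕ → ℤ
    maxTerm c@(+ _)    l u = c * + u
    maxTerm c@(-[1+ _ ]) l u = c * + l

    -- d times an upper bound of the form on the box
    above : Form → ℤ
    above ⟨ a , b , c ⟩ = maxTerm a x₀ x₁ + maxTerm b e₀ e₁ + + d * c

    magnitude : Form → ℤ
    magnitude u = max (+ 0) (max (above u) (above (⊝ u)))

    quotient : ℤ → ℕ → ℤ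
    quotient i       zero    = + 0
    quotient (+ n)   (suc m) = + (n ℕ./ suc m)
    quotient -[1+ n ] (suc m) = - + (suc n ℕ./ suc m)

    -- Makes u + p x vanish at the centre of the box, up to rounding.
    cancelling : Form → ℤ
    cancelling ⟨ a , b , c ⟩ =
      - quotient (a * + (x₀ ℕ.+ x₁) + b * + (e₀ ℕ.+ e₁) + + (d ℕ.+ d) * c) (x₀ ℕ.+ x₁)

    negPart : ℤ → ℤ
    negPart (+ _)    = + 0
    negPart -[1+ n ] = + suc n

    -- With estimate k u c t s = (t′ , s′), an orbit bounded by m satisfies
    -- d (aₙ u + aₙ₊₁ c) ≤ m (t′ − t) + d (s′ − s).  This is obtained by adding multiples
    -- p fₙ, p′ fₙ₊₁, … of the fractional parts fₙ = x aₙ + y aₙ₊₁ + aₙ₊₂, chosen such that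
    -- the coefficients of aₙ, aₙ₊₁, … in the sum are small.
    estimate      : ℕ → Form → ℤ → ℤ → ℤ → ℤ × ℤ
    estimateUsing : ℕ → Form → ℤ → ℤ → ℤ → ℤ → ℤ × ℤ

    estimate zero    u c t s = t + (magnitude u + magnitude (const c)) , s
    estimate (suc k) u c t s = estimateUsing k u c t s (cancelling u)

    estimateUsing k u c t s p =
      estimate k ⟨ p , - p , p + c ⟩ p (t + magnitude (u ⊕ ⟨ p , + 0 , + 0 ⟩)) (s + negPart p)

    -- With the starting form ± N x and |aₙ| = m, the estimate becomes m (N x₀ - t) ≤ d s. If N x₀ -
    -- t ≥ 0, the left side grows with m, so refuting m = M + 1 refutes all m > M.
    beats : ℕ → ℕ → ℤ × ℤ → Bool
    beats M N (t , s) =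
      isNonNeg (+ N * + x₀ - t) ∧ isPos (+ suc M * (+ N * + x₀ - t) - + d * s)

    -- Starting from N x instead of N makes the first multiplier exact. Both signs are needed
    -- because [0 , 1) is not symmetric.
    certified : ℕ → ℕ → ℕ → Bool
    certified k N M = beats M N (estimate k ⟨ + N , + 0 , + 0 ⟩ (+ 0) (+ 0) (+ 0)) ∧
                      beats M N (estimate k ⟨ - + N , + 0 , + 0 ⟩ (+ 0) (+ 0) (+ 0))

    -- The condition x + y ≥ 0 reads δ ≤ 2 x + 1.
    outside : Bool
    outside = x₁ ℕ.+ x₁ ℕ.+ d ℕ.<ᵇ e₀

  -- Doubling the common denominator keeps midpoints integral.
  left right lower upper : Box → Box
  left  (box d x₀ x₁ e₀ e₁) = box (d ℕ.+ d) (x₀ ℕ.+ x₀) (x₀ ℕ.+ x₁) (e₀ ℕ.+ e₀) (e₁ ℕ.+ e₁)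
  right (box d x₀ x₁ e₀ e₁) = box (d ℕ.+ d) (x₀ ℕ.+ x₁) (x₁ ℕ.+ x₁) (e₀ ℕ.+ e₀) (e₁ ℕ.+ e₁)
  lower (box d x₀ x₁ e₀ e₁) = box (d ℕ.+ d) (x₀ ℕ.+ x₀) (x₁ ℕ.+ x₁) (e₀ ℕ.+ e₀) (e₀ ℕ.+ e₁)
  upper (box d x₀ x₁ e₀ e₁) = box (d ℕ.+ d) (x₀ ℕ.+ x₀) (x₁ ℕ.+ x₁) (e₀ ℕ.+ e₁) (e₁ ℕ.+ e₁)

  wide : Box → Bool
  wide (box d x₀ x₁ e₀ e₁) = e₁ ℕ.+ x₀ ℕ.<ᵇ x₁ ℕ.+ e₀

  covered : ℕ → ℕ → ℕ → ℕ → Box → Bool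
  covered k N M zero    B = false
  covered k N M (suc h) B = outside B ∨ (certified B k N M ∨
    (if wide B
     then covered k N M h (left B) ∧ covered k N M h (right B)
     else covered k N M h (lower B) ∧ covered k N M h (upper B)))

  -- Soundness of the amplitude bounds

  module Bounding {NonNeg : Form → Set} (isCone : IsCone NonNeg)
                  {a : ℕ → ℤ} (isOrbit : IsOrbitOf NonNeg a)
                  {m} (bounded : ∀ n → ∣ a n ∣ ℕ.≤ m) where
    open IsCone isCone

    record InBox (B : Box) : Set where
      open Box B
      field
        x≥ : NonNeg ⟨ + d , + 0 , - + x₀ ⟩
        x≤ : NonNeg ⟨ - + d , + 0 , + x₁ ⟩
        δ≥ : NonNeg ⟨ + 0 , + d , - + e₀ ⟩
        δ≤ : NonNeg ⟨ + 0 , - + d , + e₁ ⟩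

    module _ {B : Box} (inBox : InBox B) where
      open Box B
      open InBox inBox

      above-x : ∀ i → NonNeg ⟨ - (+ d * i) , + 0 , maxTerm B i x₀ x₁ ⟩
      above-x (+ n) = subst NonNeg (form-≡ (eq (+ n) (+ d)) (ℤ.*-zeroʳ (+ n)) refl) (*-closed n x≤)
        where
        eq : ∀ n d → n * - d ≡ - (d * n)
        eq = solve-∀
      above-x -[1+ n ] = subst NonNeg
        (form-≡ (eq (+ suc n) (+ d)) (ℤ.*-zeroʳ (+ suc n)) (eq′ (+ suc n) (+ x₀))) (*-closed (suc n) x≥)
        where
        eq : ∀ n d → n * d ≡ - (d * - n)
        eq = solve-∀
        eq′ : ∀ n d → n * - d ≡ - n * d
        eq′ = solve-∀

      above-δ : ∀ i → NonNeg ⟨ + 0 , - (+ d * i) , maxTerm B i e₀ e₁ ⟩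
      above-δ (+ n) = subst NonNeg (form-≡ (ℤ.*-zeroʳ (+ n)) (eq (+ n) (+ d)) refl) (*-closed n δ≤)
        where
        eq : ∀ n d → n * - d ≡ - (d * n)
        eq = solve-∀
      above-δ -[1+ n ] = subst NonNeg
        (form-≡ (ℤ.*-zeroʳ (+ suc n)) (eq (+ suc n) (+ d)) (eq′ (+ suc n) (+ e₀))) (*-closed (suc n) δ≥)
        where
        eq : ∀ n d → n * d ≡ - (d * - n)
        eq = solve-∀
        eq′ : ∀ n d → n * - d ≡ - n * d
        eq′ = solve-∀

      above-bound : ∀ u → NonNeg (const (above B u) ⊕ ⊝ (+ d ⊙ u))
      above-bound ⟨ i , j , k ⟩ = subst NonNeg
        (form-≡ (eq-x (+ d * i)) (eq-δ (+ d * j)) (eq-1 (maxTerm B i x₀ x₁) (maxTerm B j e₀ e₁) (+ d * k)))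
        (+-closed (above-x i) (above-δ j))
        where
        eq-x : ∀ i → - i + + 0 ≡ + 0 + - i
        eq-x = solve-∀
        eq-δ : ∀ i → + 0 + - i ≡ + 0 + - i
        eq-δ = solve-∀
        eq-1 : ∀ s t k → s + t ≡ s + t + k + - k
        eq-1 = solve-∀

      relax : ∀ {i j} u → i ℤ.≤ j → NonNeg (const i ⊕ u) → NonNeg (const j ⊕ u)
      relax {i} {j} ⟨ b , c , e ⟩ i≤j h = subst NonNeg
        (form-≡ (eq-x b) (eq-x c) (eq-1 i j e)) (+-closed h (const⁺ (ℤ.i≤j⇒0≤j-i i≤j)))
        where
        eq-x : ∀ b → + 0 + b + + 0 ≡ + 0 + b
        eq-x = solve-∀
        eq-1 : ∀ i j e → i + e + (j - i) ≡ j + e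
        eq-1 = solve-∀

      magnitude-bound⁺ : ∀ u → NonNeg (const (magnitude B u) ⊕ ⊝ (+ d ⊙ u))
      magnitude-bound⁺ u = relax (⊝ (+ d ⊙ u))
        (ℤ.≤-trans (i≤max (above B u) (above B (⊝ u))) (j≤max (+ 0) (max (above B u) (above B (⊝ u)))))
        (above-bound u)

      magnitude-bound⁻ : ∀ u → NonNeg (const (magnitude B u) ⊕ ⊝ (+ d ⊙ ⊝ u))
      magnitude-bound⁻ u = relax (⊝ (+ d ⊙ ⊝ u))
        (ℤ.≤-trans (j≤max (above B u) (above B (⊝ u))) (j≤max (+ 0) (max (above B u) (above B (⊝ u)))))
        (above-bound (⊝ u))

      scaled : ∀ k u {t} → k ℕ.≤ m → + 0 ℤ.≤ t → NonNeg (const t ⊕ ⊝ (+ d ⊙ u)) →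
               NonNeg (const (+ m * t) ⊕ ⊝ (+ d ⊙ (+ k ⊙ u)))
      scaled k u@(⟨ b , c , e ⟩) {t} k≤m 0≤t h = relax (⊝ (+ d ⊙ (+ k ⊙ u)))
        (ℤ.*-monoʳ-≤-nonNeg t {{ℤ.nonNegative 0≤t}} (ℤ.+≤+ k≤m))
        (subst NonNeg (form-≡ (eq (+ k) (+ 0) (+ d) b) (eq (+ k) (+ 0) (+ d) c) (eq-1 (+ k) t (+ d) e))
          (*-closed k h))
        where
        eq : ∀ k t d b → k * (+ 0 + - (d * b)) ≡ + 0 + - (d * (k * b))
        eq = solve-∀
        eq-1 : ∀ k t d e → k * (t + - (d * e)) ≡ k * t + - (d * (k * e))
        eq-1 = solve-∀

      0≤magnitude : ∀ u → + 0 ℤ.≤ magnitude B u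
      0≤magnitude u = i≤max (+ 0) (max (above B u) (above B (⊝ u)))

      magnitude-bound : ∀ i u → ∣ i ∣ ℕ.≤ m → NonNeg (const (+ m * magnitude B u) ⊕ ⊝ (+ d ⊙ (i ⊙ u)))
      magnitude-bound (+ k)    u k≤m = scaled k u k≤m (0≤magnitude u) (magnitude-bound⁺ u)
      magnitude-bound -[1+ k ] u@(⟨ b , c , e ⟩) k<m = subst NonNeg
        (cong (λ v → const (+ m * magnitude B u) ⊕ ⊝ (+ d ⊙ v))
          (form-≡ (eq (+ suc k) b) (eq (+ suc k) c) (eq (+ suc k) e)))
        (scaled (suc k) (⊝ u) k<m (0≤magnitude u) (magnitude-bound⁻ u))
        where
        eq : ∀ k b → k * - b ≡ - k * b
        eq = solve-∀

      negPart-bound : ∀ p n → let f = next (a n) (a (1 ℕ.+ n)) (a (2 ℕ.+ n)) in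
                      NonNeg (const (negPart B p) ⊕ p ⊙ f)
      negPart-bound (+ k) n = +-closed (const-nonNeg 0) (*-closed k (proj₁ (isOrbit n)))
      negPart-bound -[1+ k ] n = subst NonNeg
        (form-≡ (eq (+ suc k) (a n + a (1 ℕ.+ n))) (eq (+ suc k) (- a (1 ℕ.+ n)))
          (eq-1 (+ suc k) (a (1 ℕ.+ n) + a (2 ℕ.+ n))))
        (*-closed (suc k) (subst NonNeg (⊝-involutive _) (total (proj₂ (isOrbit n)))))
        where
        eq : ∀ k b → k * (+ 0 + - b) ≡ + 0 + - k * b
        eq = solve-∀
        eq-1 : ∀ k b → k * (+ 1 + - b) ≡ k + - k * b
        eq-1 = solve-∀

      Estimate : ℕ → Form → ℤ → ℤ → ℤ → ℤ × ℤ → Set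
      Estimate n u c t s (t′ , s′) =
        NonNeg (const (+ m * (t′ - t) + + d * (s′ - s)) ⊕ ⊝ (+ d ⊙ (a n ⊙ u ⊕ a (1 ℕ.+ n) ⊙ const c)))

      -- One step is the identity aₙ u + aₙ₊₁ c = aₙ (u + p x) - p fₙ + aₙ₊₁ (p y + c) + aₙ₊₂ p. The
      -- first term costs m times a magnitude, the second at most `negPart p`, and the others are
      -- the next state, with p y = ⟨ p , - p , p ⟩. It is valid for every p; the choice of p
      -- affects only the quality of the bound.
      estimate-bound      : ∀ k n u c t s → Estimate n u c t s (estimate B k u c t s)
      estimateUsing-bound : ∀ k n u c t s p → Estimate n u c t s (estimateUsing B k u c t s p)

      estimate-bound zero n u@(⟨ b₁ , b₂ , b₃ ⟩) c t s = subst NonNeg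
        (form-≡ (eq (+ d) (a n) (a (1 ℕ.+ n)) b₁) (eq (+ d) (a n) (a (1 ℕ.+ n)) b₂)
          (eq-1 (+ d) (+ m) (a n) (a (1 ℕ.+ n)) b₃ c (magnitude B u) (magnitude B (const c)) t s))
        (+-closed (magnitude-bound (a n) u (bounded n))
                  (magnitude-bound (a (1 ℕ.+ n)) (const c) (bounded (1 ℕ.+ n))))
        where
        eq : ∀ d a a′ b → + 0 + - (d * (a * b)) + (+ 0 + - (d * (a′ * + 0))) ≡
                          + 0 + - (d * (a * b + a′ * + 0))
        eq = solve-∀
        eq-1 : ∀ d m a a′ b c q r t s → m * q + - (d * (a * b)) + (m * r + - (d * (a′ * c))) ≡
                                    m * (t + (q + r) - t) + d * (s - s) + - (d * (a * b + a′ * c))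
        eq-1 = solve-∀
      estimate-bound (suc k) n u c t s = estimateUsing-bound k n u c t s (cancelling B u)

      estimateUsing-bound k n u@(⟨ b₁ , b₂ , b₃ ⟩) c t s p = subst NonNeg
        (form-≡ (eq-x (+ d) (a n) (a (1 ℕ.+ n)) (a (2 ℕ.+ n)) b₁ p)
          (eq-δ (+ d) (a n) (a (1 ℕ.+ n)) (a (2 ℕ.+ n)) b₂ p)
          (eq-1 (+ d) (+ m) (a n) (a (1 ℕ.+ n)) (a (2 ℕ.+ n)) b₃ p c
            (magnitude B r) (negPart B p) t s (proj₁ est) (proj₂ est)))
        (+-closed (magnitude-bound (a n) r (bounded n))
          (+-closed (*-closed d (negPart-bound p n))
            (estimate-bound k (1 ℕ.+ n) ⟨ p , - p , p + c ⟩ p (t + magnitude B r) (s + negPart B p))))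
        where
        r   = u ⊕ ⟨ p , + 0 , + 0 ⟩
        est = estimateUsing B k u c t s p
        eq-x : ∀ d a a′ a″ b p →
          + 0 + - (d * (a * (b + p))) + (d * (+ 0 + p * (a + a′)) + (+ 0 + - (d * (a′ * p + a″ * + 0)))) ≡
          + 0 + - (d * (a * b + a′ * + 0))
        eq-x = solve-∀
        eq-δ : ∀ d a a′ a″ b p →
          + 0 + - (d * (a * (b + + 0))) + (d * (+ 0 + p * - a′) + (+ 0 + - (d * (a′ * - p + a″ * + 0)))) ≡
          + 0 + - (d * (a * b + a′ * + 0))
        eq-δ = solve-∀
        eq-1 : ∀ d m a a′ a″ b p c r q t s t′ s′ →
          m * r + - (d * (a * (b + + 0))) +
            (d * (q + p * (a′ + a″)) +
              (m * (t′ - (t + r)) + d * (s′ - (s + q)) + - (d * (a′ * (p + c) + a″ * p)))) ≡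
          m * (t′ - t) + d * (s′ - s) + - (d * (a * b + a′ * c))
        eq-1 = solve-∀

      beats-sound : ∀ {M N} n c {ts} → M ℕ.< m → a n * c ≡ + m * + N →
        Estimate n ⟨ c , + 0 , + 0 ⟩ (+ 0) (+ 0) (+ 0) ts → ¬ T (beats B M N ts)
      beats-sound {M} {N} n c {t , s} M<m an*c≡m*N est win = ℤ.<-irrefl refl (begin-strict
        + d * s                     <⟨ positive (proj₂ win′) ⟩
        + suc M * g                 ≤⟨ ℤ.*-monoʳ-≤-nonNeg g {{ℤ.nonNegative (nonNegative (proj₁ win′))}}
                                         (ℤ.+≤+ M<m) ⟩
        + m * g                     ≤⟨ ℤ.0≤i-j⇒j≤i (const⁻ combined) ⟩
        + d * s                     ∎)
        where
        open ℤ.≤-Reasoning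
        g = + N * + x₀ - t
        win′ = Equivalence.to (T-∧ {isNonNeg g}) win
        nonNegative : ∀ {i} → T (isNonNeg i) → + 0 ℤ.≤ i
        nonNegative {+ n} _ = ℤ.+≤+ z≤n
        positive : ∀ {i j} → T (isPos (i - j)) → j ℤ.< i
        positive {i} {j} h with i - j in eq
        ... | + suc k = ℤ.≰⇒> λ i≤j →
          ℤ.<⇒≱ (subst (+ 0 ℤ.<_) (sym eq) (ℤ.+<+ (s≤s z≤n))) (ℤ.i≤j⇒i-j≤0 i≤j)
        eq-x : ∀ d a a′ c mN → a * c ≡ mN → mN * d + (+ 0 + - (d * (a * c + a′ * + 0))) ≡ + 0
        eq-x d a a′ c .(a * c) refl = identity d a a′ c
          where
          identity : ∀ d a a′ c → a * c * d + (+ 0 + - (d * (a * c + a′ * + 0))) ≡ + 0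
          identity = solve-∀
        eq-δ : ∀ d a a′ mN → mN * + 0 + (+ 0 + - (d * (a * + 0 + a′ * + 0))) ≡ + 0
        eq-δ = solve-∀
        eq-1 : ∀ d a a′ m N x t s →
          m * N * - x + (m * (t - + 0) + d * (s - + 0) + - (d * (a * + 0 + a′ * + 0))) ≡
          d * s - m * (N * x - t)
        eq-1 = solve-∀
        combined : NonNeg (const (+ d * s - + m * g))
        combined = subst NonNeg
          (form-≡ (eq-x (+ d) (a n) (a (1 ℕ.+ n)) c (+ m * + N) an*c≡m*N)
            (eq-δ (+ d) (a n) (a (1 ℕ.+ n)) (+ m * + N))
            (eq-1 (+ d) (a n) (a (1 ℕ.+ n)) (+ m) (+ N) (+ x₀) t s))
          (+-closed (scale (subst (+ 0 ℤ.≤_) (ℤ.pos-* m N) (ℤ.+≤+ z≤n)) x≥) est)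

      certified-sound : ∀ {k N M} n → M ℕ.< m → ∣ a n ∣ ≡ m → ¬ T (certified B k N M)
      certified-sound {k} {N} {M} n M<m |an|≡m win = go (a n) refl
        where
        win′ = Equivalence.to (T-∧ {beats B M N (estimate B k ⟨ + N , + 0 , + 0 ⟩ (+ 0) (+ 0) (+ 0))}) win
        go : ∀ i → a n ≡ i → ⊥
        go (+ j) eq = beats-sound {M} {N} n (+ N) M<m
          (cong (_* + N) (trans eq (trans (cong (+_ ∘ ∣_∣) (sym eq)) (cong +_ |an|≡m))))
          (estimate-bound k n ⟨ + N , + 0 , + 0 ⟩ (+ 0) (+ 0) (+ 0)) (proj₁ win′)
        go -[1+ j ] eq = beats-sound {M} {N} n (- + N) M<m
          (trans (cong (_* - + N) (trans eq (trans (cong (-_ ∘ +_ ∘ ∣_∣) (sym eq)) (cong (-_ ∘ +_) |an|≡m))))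
            (neg-neg (+ m) (+ N)))
          (estimate-bound k n ⟨ - + N , + 0 , + 0 ⟩ (+ 0) (+ 0) (+ 0)) (proj₂ win′)
          where
          neg-neg : ∀ i j → - i * - j ≡ i * j
          neg-neg = solve-∀

      outside-sound : NonNeg ⟨ + 2 , - + 1 , + 1 ⟩ → ¬ T (outside B)
      outside-sound x+y≥0 out = ℤ.<⇒≱ (ℤ.+<+ (ℕ.<ᵇ⇒< (x₁ ℕ.+ x₁ ℕ.+ d) e₀ out))
        (ℤ.0≤i-j⇒j≤i (const⁻ (subst NonNeg
          (form-≡ (eq-x (+ d)) (eq-δ (+ d)) (eq-1 (+ d) (+ x₁) (+ e₀)))
          (+-closed (*-closed d x+y≥0) (+-closed (*-closed 2 x≤) δ≥)))))
        where
        eq-x : ∀ d → d * + 2 + (+ 2 * - d + + 0) ≡ + 0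
        eq-x = solve-∀
        eq-δ : ∀ d → d * - + 1 + (+ 2 * + 0 + d) ≡ + 0
        eq-δ = solve-∀
        eq-1 : ∀ d x e → d * + 1 + (+ 2 * x + - e) ≡ x + x + d - e
        eq-1 = solve-∀

    module _ {B : Box} (inBox : InBox B) where
      open Box B
      open InBox inBox

      private
        neg-double : ∀ n → - + n + - + n ≡ - + (n ℕ.+ n)
        neg-double n = sym (ℤ.neg-distrib-+ (+ n) (+ n))

        double : ∀ {u v} → u ⊕ u ≡ v → NonNeg u → NonNeg v
        double eq h = subst NonNeg eq (+-closed h h)

      doubled : InBox (box (d ℕ.+ d) (x₀ ℕ.+ x₀) (x₁ ℕ.+ x₁) (e₀ ℕ.+ e₀) (e₁ ℕ.+ e₁))
      doubled = record
        { x≥ = double (form-≡ refl refl (neg-double x₀)) x≥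
        ; x≤ = double (form-≡ (neg-double d) refl refl) x≤
        ; δ≥ = double (form-≡ refl refl (neg-double e₀)) δ≥
        ; δ≤ = double (form-≡ refl (neg-double d) refl) δ≤
        }

      halve-x : (InBox (left B) → ⊥) → (InBox (right B) → ⊥) → ⊥
      halve-x inLeft inRight = by-cases ⟨ + (d ℕ.+ d) , + 0 , - + (x₀ ℕ.+ x₁) ⟩
        (λ x≥mid → inRight record { InBox doubled; x≥ = x≥mid })
        (λ x≤mid → inLeft record
          { InBox doubled
          ; x≤ = subst NonNeg (form-≡ refl refl (ℤ.neg-involutive (+ (x₀ ℕ.+ x₁)))) x≤mid
          })

      halve-δ : (InBox (lower B) → ⊥) → (InBox (upper B) → ⊥) → ⊥
      halve-δ inLower inUpper = by-cases ⟨ + 0 , + (d ℕ.+ d) , - + (e₀ ℕ.+ e₁) ⟩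
        (λ δ≥mid → inUpper record { InBox doubled; δ≥ = δ≥mid })
        (λ δ≤mid → inLower record
          { InBox doubled
          ; δ≤ = subst NonNeg (form-≡ refl refl (ℤ.neg-involutive (+ (e₀ ℕ.+ e₁)))) δ≤mid
          })

    covered-sound : ∀ k N M n → M ℕ.< m → ∣ a n ∣ ≡ m → NonNeg ⟨ + 2 , - + 1 , + 1 ⟩ →
                    ∀ h B → covered k N M h B ≡ true → InBox B → ⊥
    covered-sound k N M n M<m |an|≡m x+y≥0 h₀ B₀ eq inB₀ = go h₀ inB₀ (Equivalence.from T-≡ eq)
      where
      go : ∀ h {B} → InBox B → ¬ T (covered k N M h B)
      go (suc h) {B} inB c with Equivalence.to (T-∨ {outside B}) c
      ... | inj₁ out = outside-sound inB x+y≥0 out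
      ... | inj₂ c′ with Equivalence.to (T-∨ {certified B k N M}) c′
      ... | inj₁ win = certified-sound inB {k} {N} {M} n M<m |an|≡m win
      ... | inj₂ c″ with wide B
      ... | true  = let l , r = Equivalence.to (T-∧ {covered k N M h (left B)}) c″
                    in halve-x inB (λ inL → go h inL l) (λ inR → go h inR r)
      ... | false = let l , u = Equivalence.to (T-∧ {covered k N M h (lower B)}) c″
                    in halve-δ inB (λ inL → go h inL l) (λ inU → go h inU u)

  -- Integer inequalities for the descent near δ = 0

  infixl 6 _⊞_
  infix  7 _⊠_

  _⊞_ : ∀ {i j} → + 0 ℤ.≤ i → + 0 ℤ.≤ j → + 0 ℤ.≤ i + j
  _⊞_ = ℤ.+-mono-≤ {+ 0} {_} {+ 0}

  _⊠_ : ∀ k {i} → + 0 ℤ.≤ i → + 0 ℤ.≤ + k * i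
  _⊠_ k {i} 0≤i = subst (ℤ._≤ + k * i) (ℤ.*-zeroʳ (+ k)) (ℤ.*-monoˡ-≤-nonNeg (+ k) 0≤i)

  -- Integer Farkas certificates end here: at each use the multipliers cancel all variables and
  -- leave the constant -1 - n.
  absurd : ∀ {i} → + 0 ℤ.≤ i → ∀ n → i ≡ -[1+ n ] → ⊥
  absurd { .(-[1+ n ])} () n refl

  obtain : ∀ {i} → + 0 ℤ.≤ i → ∀ {j} → i ≡ j → + 0 ℤ.≤ j
  obtain 0≤i refl = 0≤i

  sign : ∀ i → + 0 ℤ.≤ i ⊎ + 0 ℤ.≤ - i - + 1
  sign (+ n)       = inj₁ (ℤ.+≤+ z≤n)
  sign -[1+ zero ]  = inj₂ (ℤ.+≤+ z≤n)
  sign -[1+ suc n ] = inj₂ (ℤ.+≤+ z≤n)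

  by-contradiction : ∀ i → (+ 0 ℤ.≤ - i - + 1 → ⊥) → + 0 ℤ.≤ i
  by-contradiction i ¬i<0 with sign i
  ... | inj₁ 0≤i = 0≤i
  ... | inj₂ i<0 = ⊥-elim (¬i<0 i<0)

  -- For bₙ = ± (−1)ⁿ aₙ and hₙ = bₙ − bₙ₊₁ the recurrence reads
  -- hₙ₊₁ = x hₙ + δ bₙ₊₁ ± fₙ with fₙ ∈ [0 , 1) and alternating signs.  A slope of h
  -- against b as large as 2/9 is needed once δ b becomes negative; on the other hand it
  -- must be small enough for 9 h + 2 b not to decrease before.
  data Descending (M b h : ℤ) : Set where
    above-0 : + 0 ℤ.≤ b → + 0 ℤ.≤ h - + 1 →
              + 0 ℤ.≤ + 9 * h + + 2 * b - + 2 * M - + 7 → Descending M b h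
    below-0 : + 0 ℤ.≤ - b - + 1 → + 0 ℤ.≤ + 9 * h - + 2 * M - + 7 → Descending M b h

  -- Two steps of the recurrence for x ≥ 4/3 and 0 < δ ≤ 1/16, the first one with the
  -- favourable sign.
  record Steps (M b h h′ h″ : ℤ) : Set where
    field
      large  : + 0 ℤ.≤ M - + 17
      bound₁ : + 0 ℤ.≤ M + (b - h)
      bound₂ : + 0 ℤ.≤ M + (b - h - h′)
      gain⁺  : + 0 ℤ.≤ h → + 0 ℤ.≤ b - h → + 0 ℤ.≤ + 3 * h′ - + 4 * h
      gain⁻  : + 0 ℤ.≤ h → + 0 ℤ.≤ - (b - h) → + 0 ℤ.≤ + 48 * h′ - + 64 * h - + 3 * (b - h)
      loss⁺  : + 0 ℤ.≤ h′ → + 0 ℤ.≤ b - h - h′ → + 0 ℤ.≤ + 3 * h″ - + 4 * h′ + + 2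
      loss⁻  : + 0 ℤ.≤ h′ → + 0 ℤ.≤ - (b - h - h′) →
               + 0 ℤ.≤ + 48 * h″ - + 64 * h′ - + 3 * (b - h - h′) + + 47

  descending⇒h>0 : ∀ M b h → + 0 ℤ.≤ M - + 17 → Descending M b h → + 0 ℤ.≤ h - + 1
  descending⇒h>0 M b h large (above-0 _ h>0 _) = h>0
  descending⇒h>0 M b h large (below-0 _ g) = by-contradiction (h - + 1) λ h≤0 →
    absurd (9 ⊠ h≤0 ⊞ g ⊞ 2 ⊠ large) 40 (solve (M ∷ h ∷ []))

  -- Steps are taken in pairs so that the favourable one makes up for the loss of the unfavourable
  -- one. That b drops by at least 1 per pair is what ends the descent.
  keeps-descending : ∀ M b h h′ h″ → Steps M b h h′ h″ → Descending M b h →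
                     + 0 ℤ.≤ h + h′ - + 1 × Descending M (b - h - h′) h″
  keeps-descending M b h h′ h″ steps desc = obtain (h>0 ⊞ h′≥0 desc) (solve (h ∷ h′ ∷ [])) , go desc
    where
    open Steps steps
    h>0 = descending⇒h>0 M b h large desc
    h≥0 : + 0 ℤ.≤ h
    h≥0 = obtain (h>0 ⊞ ℤ.+≤+ {0} {1} z≤n) (solve (h ∷ []))

    neg : ∀ {i} → + 0 ℤ.≤ - i - + 1 → + 0 ℤ.≤ - i
    neg {i} i<0 = obtain (i<0 ⊞ ℤ.+≤+ {0} {1} z≤n) (solve (i ∷ []))

    h′>1 : + 0 ℤ.≤ b - h → + 0 ℤ.≤ h′ - + 2
    h′>1 b′≥0 = by-contradiction (h′ - + 2) λ h′≤1 →
      absurd (3 ⊠ h′≤1 ⊞ gain⁺ h≥0 b′≥0 ⊞ 4 ⊠ h>0) 0 (solve (h ∷ h′ ∷ []))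

    slope : + 0 ℤ.≤ b → + 0 ℤ.≤ + 9 * h + + 2 * b - + 2 * M - + 7 → + 0 ℤ.≤ - (b - h) - + 1 →
            + 0 ℤ.≤ + 11 * h - + 2 * M - + 9
    slope b≥0 g b′<0 = obtain (g ⊞ 2 ⊠ b′<0) (solve (M ∷ b ∷ h ∷ []))

    h′>0-above : + 0 ℤ.≤ - (b - h) - + 1 → + 0 ℤ.≤ + 11 * h - + 2 * M - + 9 → + 0 ℤ.≤ h′ - + 1
    h′>0-above b′<0 s = by-contradiction (h′ - + 1) λ h′≤0 → absurd
      (96 ⊠ h′≤0 ⊞ 2 ⊠ gain⁻ h≥0 (neg {b - h} b′<0) ⊞ 6 ⊠ bound₁ ⊞ 3 ⊠ s ⊞ 95 ⊠ h>0)
      121 (solve (M ∷ b ∷ h ∷ h′ ∷ []))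

    b′<0-below : + 0 ℤ.≤ - b - + 1 → + 0 ℤ.≤ - (b - h) - + 1
    b′<0-below b<0 = obtain (b<0 ⊞ h≥0) (solve (b ∷ h ∷ []))

    h′>0-below : + 0 ℤ.≤ - b - + 1 → + 0 ℤ.≤ + 9 * h - + 2 * M - + 7 → + 0 ℤ.≤ h′ - + 1
    h′>0-below b<0 g = by-contradiction (h′ - + 1) λ h′≤0 → absurd
      (96 ⊠ h′≤0 ⊞ 2 ⊠ gain⁻ h≥0 (neg {b - h} (b′<0-below b<0)) ⊞ 6 ⊠ bound₁ ⊞ 3 ⊠ g ⊞ 101 ⊠ h>0)
      121 (solve (M ∷ b ∷ h ∷ h′ ∷ []))

    h′≥0-from : + 0 ℤ.≤ h′ - + 1 → + 0 ℤ.≤ h′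
    h′≥0-from h′>0 = obtain (h′>0 ⊞ ℤ.+≤+ {0} {1} z≤n) (solve (h′ ∷ []))

    h′≥0-from₂ : + 0 ℤ.≤ h′ - + 2 → + 0 ℤ.≤ h′
    h′≥0-from₂ h′>1 = obtain (h′>1 ⊞ ℤ.+≤+ {0} {2} z≤n) (solve (h′ ∷ []))

    h′≥0 : Descending M b h → + 0 ℤ.≤ h′
    h′≥0 (below-0 b<0 g) = h′≥0-from (h′>0-below b<0 g)
    h′≥0 (above-0 b≥0 _ g) =
      [ h′≥0-from₂ ∘ h′>1 , (λ b′<0 → h′≥0-from (h′>0-above b′<0 (slope b≥0 g b′<0))) ]′ (sign (b - h))

    -- This is what keeps 9 h + 2 b from decreasing: since 9 h″ ≥ 12 h′ - 6, the new value is at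
    -- least 2 b - 2 h + 10 h′ - 6, which must reach 9 h + 2 b. The real inequality 3 h′ ≥ 4 h is
    -- too weak for small h, where integrality of h′ helps.
    ratio : + 0 ℤ.≤ + 3 * h′ - + 4 * h → + 0 ℤ.≤ + 10 * h′ - + 11 * h - + 6
    ratio gain = [ large-h , small-h ]′ (sign (h - + 3))
      where
      large-h : + 0 ℤ.≤ h - + 3 → + 0 ℤ.≤ + 10 * h′ - + 11 * h - + 6
      large-h h≥3 = by-contradiction (+ 10 * h′ - + 11 * h - + 6) λ r<0 →
        absurd (3 ⊠ r<0 ⊞ 10 ⊠ gain ⊞ 7 ⊠ h≥3) 5 (solve (h ∷ h′ ∷ []))
      h′>h : + 0 ℤ.≤ h′ - h - + 1
      h′>h = by-contradiction (h′ - h - + 1) λ h′≤h →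
        absurd (3 ⊠ h′≤h ⊞ gain ⊞ h>0) 0 (solve (h ∷ h′ ∷ []))
      small-h : + 0 ℤ.≤ - (h - + 3) - + 1 → + 0 ℤ.≤ + 10 * h′ - + 11 * h - + 6
      small-h h<3 = obtain (10 ⊠ h′>h ⊞ h<3 ⊞ ℤ.+≤+ {0} {2} z≤n) (solve (h ∷ h′ ∷ []))

    dip : + 0 ℤ.≤ - (b - h) - + 1 → + 0 ℤ.≤ h′ - + 1 →
          (+ 0 ℤ.≤ + 48 * h″ - + 64 * h′ - + 3 * (b - h - h′) + + 47 →
           + 0 ℤ.≤ + 48 * h′ - + 64 * h - + 3 * (b - h) → + 0 ℤ.≤ - (+ 9 * h″ - + 2 * M - + 7) - + 1 → ⊥) →
          Descending M (b - h - h′) h″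
    dip b′<0 h′>0 contra = below-0 b″<0 $ by-contradiction (+ 9 * h″ - + 2 * M - + 7) $
      contra (loss⁻ (h′≥0-from h′>0) (neg {b - h - h′} b″<0)) (gain⁻ h≥0 (neg {b - h} b′<0))
      where
      b″<0 : + 0 ℤ.≤ - (b - h - h′) - + 1
      b″<0 = obtain (b′<0 ⊞ h′≥0-from h′>0) (solve (b ∷ h ∷ h′ ∷ []))

    from-above : + 0 ℤ.≤ + 9 * h + + 2 * b - + 2 * M - + 7 → + 0 ℤ.≤ b - h →
                 Descending M (b - h - h′) h″
    from-above g b′≥0 = [ stays-above , falls-below ]′ (sign (b - h - h′))
      where
      h′>1′ : + 0 ℤ.≤ h′ - + 2
      h′>1′ = h′>1 b′≥0
      gain : + 0 ℤ.≤ + 3 * h′ - + 4 * h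
      gain = gain⁺ h≥0 b′≥0

      stays-above : + 0 ℤ.≤ b - h - h′ → Descending M (b - h - h′) h″
      stays-above b″≥0 = above-0 b″≥0 h″>0
        (obtain (g ⊞ 3 ⊠ loss ⊞ ratio gain) (solve (M ∷ b ∷ h ∷ h′ ∷ h″ ∷ [])))
        where
        loss : + 0 ℤ.≤ + 3 * h″ - + 4 * h′ + + 2
        loss = loss⁺ (h′≥0-from₂ h′>1′) b″≥0
        h″>0 : + 0 ℤ.≤ h″ - + 1
        h″>0 = by-contradiction (h″ - + 1) λ h″≤0 →
          absurd (3 ⊠ h″≤0 ⊞ loss ⊞ 4 ⊠ h′>1′) 5 (solve (h′ ∷ h″ ∷ []))

      falls-below : + 0 ℤ.≤ - (b - h - h′) - + 1 → Descending M (b - h - h′) h″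
      falls-below b″<0 = below-0 b″<0 (by-contradiction (+ 9 * h″ - + 2 * M - + 7) λ small →
        [ large-h small , small-h small ]′ (sign (h - + 3)))
        where
        loss : + 0 ℤ.≤ + 48 * h″ - + 64 * h′ - + 3 * (b - h - h′) + + 47
        loss = loss⁻ (h′≥0-from₂ h′>1′) (neg {b - h - h′} b″<0)
        large-h : + 0 ℤ.≤ - (+ 9 * h″ - + 2 * M - + 7) - + 1 → + 0 ℤ.≤ h - + 3 → ⊥
        large-h small h≥3 = absurd
          (48 ⊠ small ⊞ 9 ⊠ loss ⊞ 48 ⊠ g ⊞ 160 ⊠ gain ⊞ 69 ⊠ b″<0 ⊞ 112 ⊠ h≥3)
          29 (solve (M ∷ b ∷ h ∷ h′ ∷ h″ ∷ []))
        -- Here h ≤ 2 forces b ≥ M - 5, so a fall below 0 takes h′ ≥ M - 6, and h″ is large as well.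
        small-h : + 0 ℤ.≤ - (+ 9 * h″ - + 2 * M - + 7) - + 1 → + 0 ℤ.≤ - (h - + 3) - + 1 → ⊥
        small-h small h<3 = absurd
          (48 ⊠ small ⊞ 9 ⊠ loss ⊞ 48 ⊠ g ⊞ 240 ⊠ (g ⊞ 2 ⊠ large) ⊞ 549 ⊠ b″<0 ⊞ 3168 ⊠ h<3)
          3677 (solve (M ∷ b ∷ h ∷ h′ ∷ h″ ∷ []))

    go : Descending M b h → Descending M (b - h - h′) h″
    go (below-0 b<0 g) = dip (b′<0-below b<0) (h′>0-below b<0 g) λ loss gain small → absurd
      (3 ⊠ (48 ⊠ small ⊞ 9 ⊠ loss ⊞ 27 ⊠ bound₂ ⊞ 12 ⊠ gain ⊞ 36 ⊠ bound₁) ⊞ 256 ⊠ g ⊞ 35 ⊠ large)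
      253 (solve (M ∷ b ∷ h ∷ h′ ∷ h″ ∷ []))
    go (above-0 b≥0 _ g) = [ from-above g , crosses ]′ (sign (b - h))
      where
      crosses : + 0 ℤ.≤ - (b - h) - + 1 → Descending M (b - h - h′) h″
      crosses b′<0 = dip b′<0 h′>0 λ loss gain small → absurd
        (11 ⊠ (48 ⊠ small ⊞ 9 ⊠ loss ⊞ 48 ⊠ g ⊞ 10 ⊠ gain ⊞ 39 ⊠ b′<0 ⊞ 69 ⊠ h′>0)
          ⊞ 112 ⊠ (slope b≥0 g b′<0 ⊞ 2 ⊠ large))
        1878 (solve (M ∷ b ∷ h ∷ h′ ∷ h″ ∷ []))
        where
        h′>0 : + 0 ℤ.≤ h′ - + 1
        h′>0 = h′>0-above b′<0 (slope b≥0 g b′<0)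

  bounds : ∀ {m} i → ∣ i ∣ ℕ.≤ m → + 0 ℤ.≤ + m + i × + 0 ℤ.≤ + m - i
  bounds {m} (+ n)    n≤m = ℤ.+≤+ z≤n , ℤ.i≤j⇒0≤j-i (ℤ.+≤+ n≤m)
  bounds {m} -[1+ n ] n<m = ℤ.i≤j⇒0≤j-i {+ suc n} (ℤ.+≤+ n<m) , ℤ.+≤+ z≤n

  -- Orbits with parameters in the strip δ ≤ 1/16

  module Strip {NonNeg : Form → Set} (isCone : IsCone NonNeg)
               {a : ℕ → ℤ} (isOrbit : IsOrbitOf NonNeg a)
               {m} (bounded : ∀ n → ∣ a n ∣ ℕ.≤ m) (17≤m : 17 ℕ.≤ m)
               (4/3≤x : NonNeg ⟨ + 3 , + 0 , - + 4 ⟩)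
               (0<δ : ¬ NonNeg (⊝ ⟨ + 0 , + 1 , + 0 ⟩))
               (δ≤1/16 : NonNeg ⟨ + 0 , - + 16 , + 1 ⟩) where
    open IsCone isCone

    0≤δ : NonNeg ⟨ + 0 , + 1 , + 0 ⟩
    0≤δ = total 0<δ

    gain⁺ : ∀ b h h′ → NonNeg ⟨ - h , - b , h′ ⟩ → + 0 ℤ.≤ h → + 0 ℤ.≤ b → + 0 ℤ.≤ + 3 * h′ - + 4 * h
    gain⁺ b h h′ f 0≤h 0≤b = const⁻ $ subst NonNeg
      (form-≡ (eq-x b h) (eq-δ b h) (eq-1 b h h′))
      (+-closed (*-closed 3 f) (+-closed (scale 0≤h 4/3≤x) (scale (3 ⊠ 0≤b) 0≤δ)))
      where
      eq-x : ∀ b h → + 3 * - h + (h * + 3 + + 3 * b * + 0) ≡ + 0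
      eq-x = solve-∀
      eq-δ : ∀ b h → + 3 * - b + (h * + 0 + + 3 * b * + 1) ≡ + 0
      eq-δ = solve-∀
      eq-1 : ∀ b h h′ → + 3 * h′ + (h * - + 4 + + 3 * b * + 0) ≡ + 3 * h′ - + 4 * h
      eq-1 = solve-∀

    gain⁻ : ∀ b h h′ → NonNeg ⟨ - h , - b , h′ ⟩ → + 0 ℤ.≤ h → + 0 ℤ.≤ - b →
            + 0 ℤ.≤ + 48 * h′ - + 64 * h - + 3 * b
    gain⁻ b h h′ f 0≤h b≤0 = const⁻ $ subst NonNeg
      (form-≡ (eq-x b h) (eq-δ b h) (eq-1 b h h′))
      (+-closed (*-closed 48 f) (+-closed (scale (16 ⊠ 0≤h) 4/3≤x) (scale (3 ⊠ b≤0) δ≤1/16)))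
      where
      eq-x : ∀ b h → + 48 * - h + (+ 16 * h * + 3 + + 3 * - b * + 0) ≡ + 0
      eq-x = solve-∀
      eq-δ : ∀ b h → + 48 * - b + (+ 16 * h * + 0 + + 3 * - b * - + 16) ≡ + 0
      eq-δ = solve-∀
      eq-1 : ∀ b h h′ → + 48 * h′ + (+ 16 * h * - + 4 + + 3 * - b * + 1) ≡ + 48 * h′ - + 64 * h - + 3 * b
      eq-1 = solve-∀

    -- The bound fₙ < 1 gives 3 h′ > 4 h - 3, and integrality improves the constant to 2; the 47 in
    -- `loss⁻` arises from 48 in the same way.
    loss⁺ : ∀ b h h′ → ¬ NonNeg (⊝ ⟨ - h , - b , + 1 + h′ ⟩) → + 0 ℤ.≤ h → + 0 ℤ.≤ b →
            + 0 ℤ.≤ + 3 * h′ - + 4 * h + + 2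
    loss⁺ b h h′ f 0≤h 0≤b = by-contradiction (+ 3 * h′ - + 4 * h + + 2) λ small → f $ *-cancel 2 $
      subst NonNeg (form-≡ (eq-x b h) (eq-δ b h) (eq-1 b h h′))
        (+-closed (const⁺ small) (+-closed (scale 0≤h 4/3≤x) (scale (3 ⊠ 0≤b) 0≤δ)))
      where
      eq-x : ∀ b h → + 0 + (h * + 3 + + 3 * b * + 0) ≡ + 3 * - - h
      eq-x = solve-∀
      eq-δ : ∀ b h → + 0 + (h * + 0 + + 3 * b * + 1) ≡ + 3 * - - b
      eq-δ = solve-∀
      eq-1 : ∀ b h h′ → - (+ 3 * h′ - + 4 * h + + 2) - + 1 + (h * - + 4 + + 3 * b * + 0) ≡
                        + 3 * - (+ 1 + h′)
      eq-1 = solve-∀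

    loss⁻ : ∀ b h h′ → ¬ NonNeg (⊝ ⟨ - h , - b , + 1 + h′ ⟩) → + 0 ℤ.≤ h → + 0 ℤ.≤ - b →
            + 0 ℤ.≤ + 48 * h′ - + 64 * h - + 3 * b + + 47
    loss⁻ b h h′ f 0≤h b≤0 = by-contradiction (+ 48 * h′ - + 64 * h - + 3 * b + + 47) λ small →
      f $ *-cancel 47 $ subst NonNeg (form-≡ (eq-x b h) (eq-δ b h) (eq-1 b h h′))
        (+-closed (const⁺ small) (+-closed (scale (16 ⊠ 0≤h) 4/3≤x) (scale (3 ⊠ b≤0) δ≤1/16)))
      where
      eq-x : ∀ b h → + 0 + (+ 16 * h * + 3 + + 3 * - b * + 0) ≡ + 48 * - - h
      eq-x = solve-∀
      eq-δ : ∀ b h → + 0 + (+ 16 * h * + 0 + + 3 * - b * - + 16) ≡ + 48 * - - b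
      eq-δ = solve-∀
      eq-1 : ∀ b h h′ → - (+ 48 * h′ - + 64 * h - + 3 * b + + 47) - + 1 +
                          (+ 16 * h * - + 4 + + 3 * - b * + 1) ≡ + 48 * - (+ 1 + h′)
      eq-1 = solve-∀

    favourable : ∀ n b h h′ → a n ≡ - b → a (1 ℕ.+ n) ≡ b - h → a (2 ℕ.+ n) ≡ - (b - h - h′) →
                 NonNeg ⟨ - h , - (b - h) , h′ ⟩
    favourable n b h h′ eq₀ eq₁ eq₂ = subst NonNeg
      (form-≡ (trans (cong₂ _+_ eq₀ eq₁) (eq-x b h)) (cong -_ eq₁)
        (trans (cong₂ _+_ eq₁ eq₂) (eq-1 b h h′)))
      (proj₁ (isOrbit n))
      where
      eq-x : ∀ b h → - b + (b - h) ≡ - h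
      eq-x = solve-∀
      eq-1 : ∀ b h h′ → b - h + - (b - h - h′) ≡ h′
      eq-1 = solve-∀

    unfavourable : ∀ n b h h′ → a n ≡ b → a (1 ℕ.+ n) ≡ - (b - h) → a (2 ℕ.+ n) ≡ b - h - h′ →
                   ¬ NonNeg (⊝ ⟨ - h , - (b - h) , + 1 + h′ ⟩)
    unfavourable n b h h′ eq₀ eq₁ eq₂ = subst (λ u → ¬ NonNeg (⊝ u))
      (form-≡ (trans (cong (λ i → + 0 + - i) (cong₂ _+_ eq₀ eq₁)) (eq-x b h))
        (trans (cong (λ i → + 0 + - - i) eq₁) (eq-δ b h))
        (trans (cong (λ i → + 1 + - i) (cong₂ _+_ eq₁ eq₂)) (eq-1 b h h′)))
      (proj₂ (isOrbit n))
      where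
      eq-x : ∀ b h → + 0 + - (b + - (b - h)) ≡ - h
      eq-x = solve-∀
      eq-δ : ∀ b h → + 0 + - - - (b - h) ≡ - (b - h)
      eq-δ = solve-∀
      eq-1 : ∀ b h h′ → + 1 + - (- (b - h) + (b - h - h′)) ≡ + 1 + h′
      eq-1 = solve-∀

    0≤M-17 : + 0 ℤ.≤ + m - + 17
    0≤M-17 = ℤ.i≤j⇒0≤j-i (ℤ.+≤+ 17≤m)

    steps : ∀ n b h h′ h″ → a n ≡ - b → a (1 ℕ.+ n) ≡ b - h → a (2 ℕ.+ n) ≡ - (b - h - h′) →
            a (3 ℕ.+ n) ≡ b - h - h′ - h″ → Steps (+ m) b h h′ h″
    steps n b h h′ h″ eq₀ eq₁ eq₂ eq₃ = record
      { large  = 0≤M-17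
      ; bound₁ = subst (λ i → + 0 ℤ.≤ + m + i) eq₁ (proj₁ (bounds (a (1 ℕ.+ n)) (bounded (1 ℕ.+ n))))
      ; bound₂ = subst (λ i → + 0 ℤ.≤ + m + i) (trans (cong -_ eq₂) (ℤ.neg-involutive (b - h - h′)))
                   (proj₂ (bounds (a (2 ℕ.+ n)) (bounded (2 ℕ.+ n))))
      ; gain⁺  = gain⁺ (b - h) h h′ f
      ; gain⁻  = gain⁻ (b - h) h h′ f
      ; loss⁺  = loss⁺ (b - h - h′) h′ h″ f′
      ; loss⁻  = loss⁻ (b - h - h′) h′ h″ f′
      }
      where
      f  = favourable n b h h′ eq₀ eq₁ eq₂
      f′ = unfavourable (1 ℕ.+ n) (b - h) h′ h″ eq₁ eq₂ eq₃

    -- bₙ decreases for ever.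
    descending-absurd : ∀ k n b h → a n ≡ - b → a (1 ℕ.+ n) ≡ b - h → Descending (+ m) b h →
                        + 0 ℤ.≤ + k - (+ m + b) → ⊥
    descending-absurd k n b h eq₀ eq₁ desc = go k
      where
      h′ h″ : ℤ
      h′ = b - h + a (2 ℕ.+ n)
      h″ = b - h - h′ - a (3 ℕ.+ n)
      eq₂ : a (2 ℕ.+ n) ≡ - (b - h - h′)
      eq₂ = identity (b - h) (a (2 ℕ.+ n))
        where
        identity : ∀ i j → j ≡ - (i - (i + j))
        identity = solve-∀
      eq₃ : a (3 ℕ.+ n) ≡ b - h - h′ - h″
      eq₃ = identity (b - h - h′) (a (3 ℕ.+ n))
        where
        identity : ∀ i j → j ≡ i - (i - j)
        identity = solve-∀
      st : Steps (+ m) b h h′ h″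
      st = steps n b h h′ h″ eq₀ eq₁ eq₂ eq₃
      kept : + 0 ℤ.≤ h + h′ - + 1 × Descending (+ m) (b - h - h′) h″
      kept = keeps-descending (+ m) b h h′ h″ st desc

      go : ∀ k → + 0 ℤ.≤ + k - (+ m + b) → ⊥
      go zero left = absurd (Steps.bound₂ st ⊞ left ⊞ proj₁ kept) 0 (eq (+ m) b h h′)
        where
        eq : ∀ M b h h′ → M + (b - h - h′) + (+ 0 - (M + b)) + (h + h′ - + 1) ≡ -[1+ 0 ]
        eq = solve-∀
      go (suc k) left = descending-absurd k (2 ℕ.+ n) (b - h - h′) h″ eq₂ eq₃ (proj₂ kept)
        (obtain (left ⊞ proj₁ kept) (eq (+ m) (+ k) b h h′))
        where
        eq : ∀ M k b h h′ → + 1 + k - (M + b) + (h + h′ - + 1) ≡ k - (M + (b - h - h′))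
        eq = solve-∀

    never-descending : ∀ n b h → a n ≡ - b → a (1 ℕ.+ n) ≡ b - h → Descending (+ m) b h → ⊥
    never-descending n b h eq₀ eq₁ desc = descending-absurd ∣ + m + b ∣ n b h eq₀ eq₁ desc
      (ℤ.≤-reflexive (sym (trans (cong (_- (+ m + b)) (ℤ.0≤i⇒+∣i∣≡i 0≤M+b)) (ℤ.+-inverseʳ (+ m + b)))))
      where
      0≤M+b : + 0 ℤ.≤ + m + b
      0≤M+b = subst (λ i → + 0 ℤ.≤ + m + i) (trans (cong -_ eq₀) (ℤ.neg-involutive b))
                (proj₂ (bounds (a n) (bounded n)))

    -- The case h = h′ = 1 attains equality in 9 h′ + 2 b ≥ 2 M + 7, which makes 7 the largest
    -- constant that `Descending` can require at this start.
    unfavourable-start : ∀ M b h h′ → + 0 ℤ.≤ M - + 17 → + 0 ℤ.≤ h - + 1 → b ≡ M - h →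
      (+ 0 ℤ.≤ b → + 0 ℤ.≤ + 3 * h′ - + 4 * h + + 2) →
      (+ 0 ℤ.≤ - b → + 0 ℤ.≤ + 48 * h′ - + 64 * h - + 3 * b + + 47) → Descending M b h′
    unfavourable-start M .(M - h) h h′ large h>0 refl loss⁺ loss⁻ = [ high , low ]′ (sign (M - h))
      where
      high : + 0 ℤ.≤ M - h → Descending M (M - h) h′
      high b≥0 = above-0 b≥0 h′>0 ([ large-h , small-h ]′ (sign (h - + 2)))
        where
        loss : + 0 ℤ.≤ + 3 * h′ - + 4 * h + + 2
        loss = loss⁺ b≥0
        h′>0 : + 0 ℤ.≤ h′ - + 1
        h′>0 = by-contradiction (h′ - + 1) λ h′≤0 →
          absurd (3 ⊠ h′≤0 ⊞ loss ⊞ 4 ⊠ h>0) 1 (solve (h ∷ h′ ∷ []))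
        large-h : + 0 ℤ.≤ h - + 2 → + 0 ℤ.≤ + 9 * h′ + + 2 * (M - h) - + 2 * M - + 7
        large-h h>1 = obtain (3 ⊠ loss ⊞ 10 ⊠ h>1 ⊞ ℤ.+≤+ {0} {7} z≤n) (solve (M ∷ h ∷ h′ ∷ []))
        small-h : + 0 ℤ.≤ - (h - + 2) - + 1 → + 0 ℤ.≤ + 9 * h′ + + 2 * (M - h) - + 2 * M - + 7
        small-h h≤1 = obtain (9 ⊠ h′>0 ⊞ 2 ⊠ h≤1) (solve (M ∷ h ∷ h′ ∷ []))
      low : + 0 ℤ.≤ - (M - h) - + 1 → Descending M (M - h) h′
      low b<0 = below-0 b<0 (by-contradiction (+ 9 * h′ - + 2 * M - + 7) λ small → absurd
        (48 ⊠ small ⊞ 9 ⊠ loss ⊞ 549 ⊠ b<0 ⊞ 480 ⊠ large) 7997 (solve (M ∷ h ∷ h′ ∷ [])))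
        where
        loss : + 0 ℤ.≤ + 48 * h′ - + 64 * h - + 3 * (M - h) + + 47
        loss = loss⁻ (obtain (b<0 ⊞ ℤ.+≤+ {0} {1} z≤n) (solve (M ∷ h ∷ [])))

    from-top : ∀ n → a n ≡ + m → + 0 ℤ.≤ + m + a (1 ℕ.+ n) - + 1 → ⊥
    from-top n eq₀ h>0 = never-descending (1 ℕ.+ n) (+ m - h) h′ eq₁ eq₂
      (unfavourable-start (+ m) (+ m - h) h h′ 0≤M-17 h>0 refl
        (loss⁺ (+ m - h) h h′ f 0≤h) (loss⁻ (+ m - h) h h′ f 0≤h))
      where
      h h′ : ℤ
      h  = + m + a (1 ℕ.+ n)
      h′ = + m - h - a (2 ℕ.+ n)
      0≤h : + 0 ℤ.≤ h
      0≤h = proj₁ (bounds (a (1 ℕ.+ n)) (bounded (1 ℕ.+ n)))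
      eq₁ : a (1 ℕ.+ n) ≡ - (+ m - h)
      eq₁ = identity (+ m) (a (1 ℕ.+ n))
        where
        identity : ∀ i j → j ≡ - (i - (i + j))
        identity = solve-∀
      eq₂ : a (2 ℕ.+ n) ≡ + m - h - h′
      eq₂ = identity (+ m - h) (a (2 ℕ.+ n))
        where
        identity : ∀ i j → j ≡ i - (i - j)
        identity = solve-∀
      f = unfavourable n (+ m) h h′ eq₀ eq₁ eq₂

    bottom : ∀ n → a n ≡ - + m → ⊥
    bottom n eq₀ = [ rising , level ]′ (sign (h - + 1))
      where
      h : ℤ
      h = + m - a (1 ℕ.+ n)
      0≤h : + 0 ℤ.≤ h
      0≤h = proj₂ (bounds (a (1 ℕ.+ n)) (bounded (1 ℕ.+ n)))
      rising : + 0 ℤ.≤ h - + 1 → ⊥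
      rising h>0 = never-descending n (+ m) h eq₀ (eq₁ (+ m) (a (1 ℕ.+ n)))
        (above-0 (ℤ.+≤+ z≤n) h>0 (obtain (9 ⊠ h>0 ⊞ ℤ.+≤+ {0} {2} z≤n) (eq (+ m) h)))
        where
        eq₁ : ∀ i j → j ≡ i - (i - j)
        eq₁ = solve-∀
        eq : ∀ M h → + 9 * (h - + 1) + + 2 ≡ + 9 * h + + 2 * M - + 2 * M - + 7
        eq = solve-∀
      level : + 0 ℤ.≤ - (h - + 1) - + 1 → ⊥
      -- The continuation -m, m, -m is impossible, since it would give fₙ = -m δ < 0. So b falls
      -- properly after the value m.
      level h≤0 = from-top (1 ℕ.+ n) a₁≡m (by-contradiction _ λ h′≤0 → 0<δ (*-cancel (ℕ.pred m)
          (subst NonNeg (form-≡ (eq-x (+ m)) (eq-δ m 17≤m) (eq-1 (+ m) (a (2 ℕ.+ n))))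
            (+-closed (subst NonNeg (form-≡ (cong₂ _+_ eq₀ a₁≡m) (cong -_ a₁≡m) (cong (_+ a (2 ℕ.+ n)) a₁≡m))
                        (proj₁ (isOrbit n)))
                      (const⁺ h′≤0)))))
        where
        h≡0 : h ≡ + 0
        h≡0 = ℤ.≤-antisym (ℤ.0≤i-j⇒j≤i (obtain h≤0 (eq h))) 0≤h
          where
          eq : ∀ h → - (h - + 1) - + 1 ≡ + 0 - h
          eq = solve-∀
        a₁≡m : a (1 ℕ.+ n) ≡ + m
        a₁≡m = trans (identity (+ m) (a (1 ℕ.+ n))) (trans (cong (λ i → + m - i) h≡0) (ℤ.+-identityʳ (+ m)))
          where
          identity : ∀ i j → j ≡ i - (i - j)
          identity = solve-∀
        eq-x : ∀ M → - M + M + + 0 ≡ + suc (ℕ.pred m) * + 0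
        eq-x M = trans (identity M) (sym (ℤ.*-zeroʳ (+ suc (ℕ.pred m))))
          where
          identity : ∀ M → - M + M + + 0 ≡ + 0
          identity = solve-∀
        eq-δ : ∀ m → 17 ℕ.≤ m → - + m + + 0 ≡ + suc (ℕ.pred m) * - + 1
        eq-δ (suc m) _ = identity (+ suc m)
          where
          identity : ∀ M → - M + + 0 ≡ M * - + 1
          identity = solve-∀
        eq-1 : ∀ M i → M + i + (- (M + i - + 1) - + 1) ≡ + suc (ℕ.pred m) * + 0
        eq-1 M i = trans (identity M i) (sym (ℤ.*-zeroʳ (+ suc (ℕ.pred m))))
          where
          identity : ∀ M i → M + i + (- (M + i - + 1) - + 1) ≡ + 0
          identity = solve-∀

    top : ∀ n → a n ≡ + m → ⊥
    top n eq₀ = [ from-top n eq₀ , (λ h≤0 → bottom (1 ℕ.+ n) (a₁≡-m h≤0)) ]′ (sign (h - + 1))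
      where
      h : ℤ
      h = + m + a (1 ℕ.+ n)
      a₁≡-m : + 0 ℤ.≤ - (h - + 1) - + 1 → a (1 ℕ.+ n) ≡ - + m
      a₁≡-m h≤0 = trans (identity (+ m) (a (1 ℕ.+ n)))
        (trans (cong (λ i → i - + m) h≡0) (ℤ.+-identityˡ (- + m)))
        where
        identity : ∀ i j → j ≡ i + j - i
        identity = solve-∀
        eq : ∀ h → - (h - + 1) - + 1 ≡ + 0 - h
        eq = solve-∀
        h≡0 : h ≡ + 0
        h≡0 = ℤ.≤-antisym (ℤ.0≤i-j⇒j≤i (obtain h≤0 (eq h)))
                (proj₁ (bounds (a (1 ℕ.+ n)) (bounded (1 ℕ.+ n))))

    strip-sound : ∀ n → ¬ ∣ a n ∣ ≡ m
    strip-sound n |an|≡m = go (a n) refl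
      where
      go : ∀ i → a n ≡ i → ⊥
      go (+ j)    eq = top n (trans eq (trans (cong (+_ ∘ ∣_∣) (sym eq)) (cong +_ |an|≡m)))
      go -[1+ j ] eq = bottom n (trans eq (trans (cong (-_ ∘ +_ ∘ ∣_∣) (sym eq)) (cong (-_ ∘ +_) |an|≡m)))

  -- Evaluated certificates and the cases of the amplitude

  interval : ℕ → ℕ → List ℕ
  interval l k = map (l ℕ.+_) (upTo k)

  ∈-interval : ∀ {l m} k → l ℕ.≤ m → m ℕ.< l ℕ.+ k → m ∈ interval l k
  ∈-interval {l} {m} k l≤m m<l+k = subst (_∈ interval l k) (ℕ.m+[n∸m]≡n l≤m)
    (∈-map⁺ (l ℕ.+_) (∈-upTo⁺ (ℕ.+-cancelˡ-< l (m ℕ.∸ l) k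
      (subst (ℕ._< l ℕ.+ k) (sym (ℕ.m+[n∸m]≡n l≤m)) m<l+k))))

  -- The edges are listed counterclockwise. The last one bounds δ from above: by x + y ≥ 0 in
  -- general, and by 1/16 in the strip.
  strip base : List Constraint
  base =
    (⟨ + 3 , + 0 , - + 4 ⟩ , false) ∷ (⟨ + 0 , + 1 , + 0 ⟩ , true) ∷
    (⟨ - + 2 , + 0 , + 7 ⟩ , false) ∷ (⟨ + 2 , - + 1 , + 1 ⟩ , false) ∷ []
  strip =
    (⟨ + 3 , + 0 , - + 4 ⟩ , false) ∷ (⟨ + 0 , + 1 , + 0 ⟩ , true) ∷
    (⟨ - + 2 , + 0 , + 7 ⟩ , false) ∷ (⟨ + 0 , - + 16 , + 1 ⟩ , false) ∷ []

  opaque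
    unfolding allEscape

    -- The box is 4/3 ≤ x ≤ 7/2, 1/16 ≤ δ ≤ 8; the bound 12 on the amplitude is proved with
    -- 50 terms of the power series, scaled by 4096, on boxes of bisection depth at most 16.
    covered-δ≥1/16 : covered 50 4096 12 16 (box 48 64 168 3 384) ≡ true
    covered-δ≥1/16 = refl

    base-escapes : all (allEscape base) (interval 1 12) ≡ true
    base-escapes = refl

    -- The amplitudes 13, ..., 16 fill the gap between the bound 12, available for δ ≥ 1/16, and the
    -- hypothesis m ≥ 17 of the descent.
    strip-escapes : all (allEscape strip) (interval 13 4) ≡ true
    strip-escapes = refl

  module _ {NonNeg : Form → Set} (isCone : IsCone NonNeg)
           (4/3≤x : NonNeg ⟨ + 3 , + 0 , - + 4 ⟩) (x≤7/2 : NonNeg ⟨ - + 2 , + 0 , + 7 ⟩)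
           (0<δ : ¬ NonNeg (⊝ ⟨ + 0 , + 1 , + 0 ⟩)) (0≤x+y : NonNeg ⟨ + 2 , - + 1 , + 1 ⟩)
           {a : ℕ → ℤ} (isOrbit : IsOrbitOf NonNeg a)
           {m : ℕ} (bounded : ∀ n → ∣ a n ∣ ℕ.≤ m) where
    open IsCone isCone
    open Search isCone
    open Bounding isCone {a} isOrbit bounded

    small-amplitude : 1 ℕ.≤ m → m ℕ.≤ 12 → ∀ n → ¬ ∣ a n ∣ ≡ m
    small-amplitude 1≤m m≤12 = allEscape-sound {a} isOrbit bounded {base}
      (4/3≤x All.∷ 0<δ All.∷ x≤7/2 All.∷ 0≤x+y All.∷ All.[])
      (all-lookup (allEscape base) (interval 1 12) base-escapes {m} (∈-interval 12 1≤m (s≤s m≤12)))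

    large-amplitude : 12 ℕ.< m → NonNeg ⟨ + 0 , + 16 , - + 1 ⟩ → ∀ n → ¬ ∣ a n ∣ ≡ m
    large-amplitude 12<m 1/16≤δ n |an|≡m =
      covered-sound 50 4096 12 n 12<m |an|≡m 0≤x+y 16 (box 48 64 168 3 384) covered-δ≥1/16 inBox
      where
      inBox : InBox (box 48 64 168 3 384)
      inBox = record
        { x≥ = *-closed 16 4/3≤x
        ; x≤ = *-closed 24 x≤7/2
        ; δ≥ = *-closed 3 1/16≤δ
        -- The sum of 2 x - δ + 1 ≥ 0 and 7 - 2 x ≥ 0 is δ ≤ 8.
        ; δ≤ = *-closed 48 (+-closed 0≤x+y x≤7/2)
        }

    strip-amplitude : 12 ℕ.< m → m ℕ.≤ 16 → NonNeg ⟨ + 0 , - + 16 , + 1 ⟩ → ∀ n → ¬ ∣ a n ∣ ≡ m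
    strip-amplitude 12<m m≤16 δ≤1/16 = allEscape-sound {a} isOrbit bounded {strip}
      (4/3≤x All.∷ 0<δ All.∷ x≤7/2 All.∷ δ≤1/16 All.∷ All.[])
      (all-lookup (allEscape strip) (interval 13 4) strip-escapes {m} (∈-interval 4 12<m (s≤s m≤16)))

    no-bounded-orbit : 1 ℕ.≤ m → ∀ n → ¬ ∣ a n ∣ ≡ m
    no-bounded-orbit 1≤m n |an|≡m with m ℕ.≤? 12 | m ℕ.≤? 16
    ... | yes m≤12 | _        = small-amplitude 1≤m m≤12 n |an|≡m
    ... | no  m≰12 | yes m≤16 = by-cases ⟨ + 0 , + 16 , - + 1 ⟩
      (λ 1/16≤δ → large-amplitude (ℕ.≰⇒> m≰12) 1/16≤δ n |an|≡m)
      (λ δ≤1/16 → strip-amplitude (ℕ.≰⇒> m≰12) m≤16 δ≤1/16 n |an|≡m)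
    ... | no  m≰12 | no  m≰16 = by-cases ⟨ + 0 , + 16 , - + 1 ⟩
      (λ 1/16≤δ → large-amplitude (ℕ.≰⇒> m≰12) 1/16≤δ n |an|≡m)
      (λ δ≤1/16 → Strip.strip-sound isCone {a} isOrbit bounded (ℕ.≰⇒> m≰16) 4/3≤x 0<δ δ≤1/16 n |an|≡m)

open BoundedOrbits using
  (Form; ⟨_,_,_⟩; _⊕_; _⊙_; ⊝_; const; IsCone; IsOrbitOf; next; no-bounded-orbit)

open import Data.Nat.DivMod using (_%_; m≡m%n+[m/n]*n; m%n<n)
open import Data.Rational as ℚ using (ℚ; 0ℚ; 1ℚ; ½; _/_)
import Data.Rational.Literals as ℚ
import Data.Rational.Properties as ℚ
open import Data.Rational.Solver using (module +-*-Solver)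
open import Defs
open import Relation.Unary using (_∩_; _⊆_)

-- Nonnegative Cauchy sequences

fromℤ-+ : ∀ i j → ℚ.fromℤ (i ℤ.+ j) ≡ ℚ.fromℤ i ℚ.+ ℚ.fromℤ j
fromℤ-+ i j = sym (trans
  (cong (ℚ._/ 1) (cong₂ ℤ._+_ (ℤ.*-identityʳ i) (ℤ.*-identityʳ j)))
  (ℚ.↥p/↧p≡p (ℚ.fromℤ (i ℤ.+ j))))

fromℤ-* : ∀ i j → ℚ.fromℤ (i ℤ.* j) ≡ ℚ.fromℤ i ℚ.* ℚ.fromℤ j
fromℤ-* i j = sym (ℚ.↥p/↧p≡p (ℚ.fromℤ (i ℤ.* j)))

fromℤ-neg : ∀ i → ℚ.fromℤ (ℤ.- i) ≡ ℚ.- ℚ.fromℤ i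
fromℤ-neg (+ zero)  = refl
fromℤ-neg (+ suc n) = refl
fromℤ-neg -[1+ n ]  = refl

infixl 6 _⊹_

_⊹_ : ∀ {p q} → 0ℚ ℚ.< p → 0ℚ ℚ.< q → 0ℚ ℚ.< p ℚ.+ q
_⊹_ = ℚ.+-mono-< {0ℚ} {_} {0ℚ}

*-pos : ∀ {p q} → 0ℚ ℚ.< p → 0ℚ ℚ.< q → 0ℚ ℚ.< p ℚ.* q
*-pos {p} {q} 0<p 0<q = subst (ℚ._< p ℚ.* q) (ℚ.*-zeroʳ p) (ℚ.*-monoʳ-<-pos p {{ℚ.positive 0<p}} 0<q)

pos : ∀ q .{{_ : ℚ.Positive q}} → 0ℚ ℚ.< q
pos q = ℚ.positive⁻¹ q

infix 7 _⊛_

_⊛_ : ∀ q .{{_ : ℚ.Positive q}} {p} → 0ℚ ℚ.< p → 0ℚ ℚ.< q ℚ.* p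
q ⊛ 0<p = *-pos (pos q) 0<p

halve : ∀ {ε} → 0ℚ ℚ.< ε → 0ℚ ℚ.< ½ ℚ.* ε
halve = ½ ⊛_

difference : ∀ {p q} → p ℚ.< q → 0ℚ ℚ.< q ℚ.- p
difference {p} {q} p<q = subst (ℚ._< q ℚ.- p) (ℚ.+-inverseʳ p) (ℚ.+-monoˡ-< (ℚ.- p) p<q)

difference⁻ : ∀ {p q} → 0ℚ ℚ.< q ℚ.- p → p ℚ.< q
difference⁻ {p} {q} h = subst₂ ℚ._<_ (ℚ.+-identityˡ p) (eq q p) (ℚ.+-monoˡ-< p h)
  where
  eq : ∀ q p → q ℚ.- p ℚ.+ p ≡ q
  eq = solve 2 (λ q p → q :- p :+ p := q) refl
    where open +-*-Solver

clash : ∀ {p} q .{{_ : ℚ.NonNegative q}} → 0ℚ ℚ.< p → p ≡ ℚ.- q → ⊥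
clash q 0<p refl = ℚ.<-irrefl refl (ℚ.<-≤-trans 0<p (ℚ.neg-antimono-≤ (ℚ.nonNegative⁻¹ q)))

∣p∣<ε : ∀ {p ε} → p ℚ.< ε → ℚ.- p ℚ.< ε → ℚ.∣ p ∣ ℚ.< ε
∣p∣<ε {p} p<ε -p<ε with ℚ.∣p∣≡p∨∣p∣≡-p p
... | inj₁ eq = subst (ℚ._< _) (sym eq) p<ε
... | inj₂ eq = subst (ℚ._< _) (sym eq) -p<ε

∣p∣<ε⇒p<ε : ∀ {p ε} → ℚ.∣ p ∣ ℚ.< ε → p ℚ.< ε
∣p∣<ε⇒p<ε {p} h with ℚ.≤-total 0ℚ p
... | inj₁ 0≤p = subst (ℚ._< _) (ℚ.0≤p⇒∣p∣≡p 0≤p) h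
... | inj₂ p≤0 = ℚ.≤-<-trans p≤0 (ℚ.≤-<-trans (ℚ.0≤∣p∣ p) h)

∣p∣<ε⇒-p<ε : ∀ {p ε} → ℚ.∣ p ∣ ℚ.< ε → ℚ.- p ℚ.< ε
∣p∣<ε⇒-p<ε {p} h = ∣p∣<ε⇒p<ε (subst (ℚ._< _) (sym (ℚ.∣-p∣≡∣p∣ p)) h)

Eventually : (ℕ → Set) → Set
Eventually P = ∃ λ N → ∀ {n} → N ℕ.≤ n → P n

both : ∀ {P Q} → Eventually P → Eventually Q → Eventually (λ n → P n × Q n)
both (M , p) (N , q) = M ℕ.⊔ N , λ ≤n →
  p (ℕ.m⊔n≤o⇒m≤o M N ≤n) , q (ℕ.m⊔n≤o⇒n≤o M N ≤n)

eventually-map : ∀ {P Q : ℕ → Set} → (∀ n → P n → Q n) → Eventually P → Eventually Q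
eventually-map f (N , p) = N , λ {n} ≤n → f n (p ≤n)

never : ∀ {P : ℕ → Set} → (∀ n → P n → ⊥) → Eventually P → ⊥
never f (N , p) = f N (p ℕ.≤-refl)

-- Since `_≤_` is a negation, it provides no index to work with. This positive form does, so
-- finitely many inequalities can be added and refuted at one common index by `never`.
record NonNegSeq (s : ℕ → ℚ) : Set where
  constructor nonNegSeq
  field
    eventually> : ∀ {ε} → 0ℚ ℚ.< ε → Eventually (λ n → 0ℚ ℚ.< s n ℚ.+ ε)

open NonNegSeq

seq-≡ : ∀ {s t} → (∀ n → s n ≡ t n) → NonNegSeq s → NonNegSeq t
seq-≡ eq h = nonNegSeq λ {ε} 0<ε →
  eventually-map (λ n → subst (λ p → 0ℚ ℚ.< p ℚ.+ ε) (eq n)) (eventually> h 0<ε)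

seq-+ : ∀ {s t} → NonNegSeq s → NonNegSeq t → NonNegSeq (λ n → s n ℚ.+ t n)
seq-+ {s} {t} hs ht = nonNegSeq λ {ε} 0<ε → eventually-map
  (λ n (ps , pt) → subst (0ℚ ℚ.<_) (eq (s n) (t n) ε) (ps ⊹ pt))
  (both (eventually> hs (halve 0<ε)) (eventually> ht (halve 0<ε)))
  where
  eq : ∀ p q ε → p ℚ.+ ½ ℚ.* ε ℚ.+ (q ℚ.+ ½ ℚ.* ε) ≡ p ℚ.+ q ℚ.+ ε
  eq = solve 3 (λ p q ε → p :+ con ½ :* ε :+ (q :+ con ½ :* ε) := p :+ q :+ ε) refl
    where open +-*-Solver

seq-const : ∀ {q} → 0ℚ ℚ.≤ q → NonNegSeq (λ _ → q)
seq-const 0≤q = nonNegSeq λ 0<ε → 0 , λ _ → ℚ.+-mono-≤-< 0≤q 0<ε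

seq-* : ∀ k {s} → NonNegSeq s → NonNegSeq (λ n → ℚ.fromℤ (+ k) ℚ.* s n)
seq-* zero    {s} h = seq-≡ (λ n → sym (ℚ.*-zeroˡ (s n))) (seq-const ℚ.≤-refl)
seq-* (suc k) {s} h = seq-≡ eq (seq-+ h (seq-* k h))
  where
  eq : ∀ n → s n ℚ.+ ℚ.fromℤ (+ k) ℚ.* s n ≡ ℚ.fromℤ (+ suc k) ℚ.* s n
  eq n = trans (distrib (s n) (ℚ.fromℤ (+ k))) (cong (ℚ._* s n) (sym (fromℤ-+ (+ 1) (+ k))))
    where
    distrib : ∀ p q → p ℚ.+ q ℚ.* p ≡ (1ℚ ℚ.+ q) ℚ.* p
    distrib = solve 2 (λ p q → p :+ q :* p := (con 1ℚ :+ q) :* p) refl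
      where open +-*-Solver

seq-*-cancel : ∀ k {s} → NonNegSeq (λ n → ℚ.fromℤ (+ suc k) ℚ.* s n) → NonNegSeq s
seq-*-cancel k {s} h = nonNegSeq λ {ε} 0<ε → eventually-map
  (λ n p → ℚ.*-cancelˡ-<-nonNeg K (subst₂ ℚ._<_ (sym (ℚ.*-zeroʳ K)) (sym (ℚ.*-distribˡ-+ K (s n) ε)) p))
  (eventually> h (K ⊛ 0<ε))
  where K = ℚ.fromℤ (+ suc k)

Negative : (ℕ → ℚ) → Set
Negative s = ∃ λ ε → 0ℚ ℚ.< ε × Eventually (λ n → s n ℚ.+ ε ℚ.< 0ℚ)

private
  -- One far term decides: with η = ε / 4, either the N-th term exceeds -2 η, and all later ones
  -- exceed -3 η, or it does not, and all later ones stay below -η.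
  converge : ∀ x → ¬ Negative (seq x) → ∀ {ε} → 0ℚ ℚ.< ε → Eventually (λ n → 0ℚ ℚ.< seq x n ℚ.+ ε)
  converge x ¬neg {ε} 0<ε = go (ℚ.<-cmp 0ℚ (seq x N ℚ.+ (η ℚ.+ η)))
    where
    η = ½ ℚ.* (½ ℚ.* ε)
    0<η = halve (halve 0<ε)
    N = proj₁ (cauchy x 0<η)
    close : ∀ {n} → N ℕ.≤ n → ℚ.∣ seq x N ℚ.- seq x n ∣ ℚ.< η
    close = proj₂ (cauchy x 0<η) ℕ.≤-refl
    open import Relation.Binary.Definitions using (Tri; tri<; tri≈; tri>)
    low : seq x N ℚ.+ (η ℚ.+ η) ℚ.≤ 0ℚ → Negative (seq x)
    low h = η , 0<η , N , λ {n} ≤n → ℚ.<-≤-trans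
      (difference⁻ (subst (0ℚ ℚ.<_) (eq (seq x N) (seq x n) η)
        (difference (∣p∣<ε⇒-p<ε {seq x N ℚ.- seq x n} (close ≤n))))) h
      where
      eq : ∀ p q η → η ℚ.- ℚ.- (p ℚ.- q) ≡ p ℚ.+ (η ℚ.+ η) ℚ.- (q ℚ.+ η)
      eq = solve 3 (λ p q η → η :- :- (p :- q) := p :+ (η :+ η) :- (q :+ η)) refl
        where open +-*-Solver
    go : Tri (0ℚ ℚ.< seq x N ℚ.+ (η ℚ.+ η)) (0ℚ ≡ seq x N ℚ.+ (η ℚ.+ η)) (seq x N ℚ.+ (η ℚ.+ η) ℚ.< 0ℚ) →
         Eventually (λ n → 0ℚ ℚ.< seq x n ℚ.+ ε)
    go (tri< h _ _) = N , λ {n} ≤n → subst (0ℚ ℚ.<_) (eq (seq x N) (seq x n) ε)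
      (h ⊹ difference (∣p∣<ε⇒p<ε {seq x N ℚ.- seq x n} (close ≤n)) ⊹ 0<η)
      where
      eq : ∀ p q ε → let η = ½ ℚ.* (½ ℚ.* ε) in
           p ℚ.+ (η ℚ.+ η) ℚ.+ (η ℚ.- (p ℚ.- q)) ℚ.+ η ≡ q ℚ.+ ε
      eq = solve 3 (λ p q ε → let η = con ½ :* (con ½ :* ε) in
                    p :+ (η :+ η) :+ (η :- (p :- q)) :+ η := q :+ ε) refl
        where open +-*-Solver
    go (tri≈ _ h _) = ⊥-elim (¬neg (low (ℚ.≤-reflexive (sym h))))
    go (tri> _ _ h) = ⊥-elim (¬neg (low (ℚ.<⇒≤ h)))

¬negative⇒nonNeg : ∀ x → ¬ Negative (seq x) → NonNegSeq (seq x)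
¬negative⇒nonNeg x ¬neg = nonNegSeq λ {ε} 0<ε → converge x ¬neg 0<ε

≤⇒nonNeg : ∀ x y → x ≤ y → NonNegSeq (λ n → seq y n ℚ.- seq x n)
≤⇒nonNeg x y x≤y = ¬negative⇒nonNeg (y - x) λ (ε , 0<ε , h) → x≤y (ε , 0<ε ,
  eventually-map (λ n p → difference⁻ (subst (0ℚ ℚ.<_) (eq (seq x n) (seq y n) ε) (difference p))) h)
  where
  eq : ∀ p q ε → 0ℚ ℚ.- (q ℚ.- p ℚ.+ ε) ≡ p ℚ.- (q ℚ.+ ε)
  eq = solve 3 (λ p q ε → con 0ℚ :- (q :- p :+ ε) := p :- (q :+ ε)) refl
    where open +-*-Solver

nonNeg⇒≤ : ∀ x y → NonNegSeq (λ n → seq y n ℚ.- seq x n) → x ≤ y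
nonNeg⇒≤ x y h (ε , 0<ε , lt) = never
  (λ n (p , q) → clash 0ℚ (p ⊹ difference q) (eq (seq x n) (seq y n) ε)) (both (eventually> h 0<ε) lt)
  where
  eq : ∀ p q ε → q ℚ.- p ℚ.+ ε ℚ.+ (p ℚ.- (q ℚ.+ ε)) ≡ ℚ.- 0ℚ
  eq = solve 3 (λ p q ε → q :- p :+ ε :+ (p :- (q :+ ε)) := :- con 0ℚ) refl
    where open +-*-Solver

-- Evaluation of forms at real parameters

module Valuation (x y : ℝ) where
  value : Form → ℝ
  value ⟨ a , b , c ⟩ = fromℤ a * x + fromℤ b * (x + fromℚ 1ℚ - y) + fromℤ c

  NonNeg : Form → Set
  NonNeg u = NonNegSeq (seq (value u))

  private
    evaluate : ℚ → ℚ → ℚ → ℚ → ℚ → ℚ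
    evaluate a b c p q = a ℚ.* p ℚ.+ b ℚ.* (p ℚ.+ 1ℚ ℚ.- q) ℚ.+ c

    evaluate-cong : ∀ {a a′ b b′ c c′} n → a ≡ a′ → b ≡ b′ → c ≡ c′ →
      evaluate a b c (seq x n) (seq y n) ≡ evaluate a′ b′ c′ (seq x n) (seq y n)
    evaluate-cong n refl refl refl = refl

  value-⊕ : ∀ u v n → seq (value u) n ℚ.+ seq (value v) n ≡ seq (value (u ⊕ v)) n
  value-⊕ ⟨ a , b , c ⟩ ⟨ a′ , b′ , c′ ⟩ n = trans
    (eq (ℚ.fromℤ a) (ℚ.fromℤ b) (ℚ.fromℤ c) (ℚ.fromℤ a′) (ℚ.fromℤ b′) (ℚ.fromℤ c′) (seq x n) (seq y n))
    (sym (evaluate-cong n (fromℤ-+ a a′) (fromℤ-+ b b′) (fromℤ-+ c c′)))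
    where
    eq : ∀ a b c a′ b′ c′ p q → evaluate a b c p q ℚ.+ evaluate a′ b′ c′ p q ≡
                                evaluate (a ℚ.+ a′) (b ℚ.+ b′) (c ℚ.+ c′) p q
    eq = solve 8 (λ a b c a′ b′ c′ p q →
      (a :* p :+ b :* (p :+ con 1ℚ :- q) :+ c) :+ (a′ :* p :+ b′ :* (p :+ con 1ℚ :- q) :+ c′) :=
      (a :+ a′) :* p :+ (b :+ b′) :* (p :+ con 1ℚ :- q) :+ (c :+ c′)) refl
      where open +-*-Solver

  value-⊙ : ∀ k u n → ℚ.fromℤ k ℚ.* seq (value u) n ≡ seq (value (k ⊙ u)) n
  value-⊙ k ⟨ a , b , c ⟩ n = trans
    (eq (ℚ.fromℤ k) (ℚ.fromℤ a) (ℚ.fromℤ b) (ℚ.fromℤ c) (seq x n) (seq y n))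
    (sym (evaluate-cong n (fromℤ-* k a) (fromℤ-* k b) (fromℤ-* k c)))
    where
    eq : ∀ k a b c p q → k ℚ.* evaluate a b c p q ≡ evaluate (k ℚ.* a) (k ℚ.* b) (k ℚ.* c) p q
    eq = solve 6 (λ k a b c p q → k :* (a :* p :+ b :* (p :+ con 1ℚ :- q) :+ c) :=
      (k :* a) :* p :+ (k :* b) :* (p :+ con 1ℚ :- q) :+ k :* c) refl
      where open +-*-Solver

  value-⊝ : ∀ u n → ℚ.- seq (value u) n ≡ seq (value (⊝ u)) n
  value-⊝ ⟨ a , b , c ⟩ n = trans
    (eq (ℚ.fromℤ a) (ℚ.fromℤ b) (ℚ.fromℤ c) (seq x n) (seq y n))
    (sym (evaluate-cong n (fromℤ-neg a) (fromℤ-neg b) (fromℤ-neg c)))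
    where
    eq : ∀ a b c p q → ℚ.- evaluate a b c p q ≡ evaluate (ℚ.- a) (ℚ.- b) (ℚ.- c) p q
    eq = solve 5 (λ a b c p q → :- (a :* p :+ b :* (p :+ con 1ℚ :- q) :+ c) :=
      (:- a) :* p :+ (:- b) :* (p :+ con 1ℚ :- q) :+ :- c) refl
      where open +-*-Solver

  value-const : ∀ i n → seq (value (const i)) n ≡ ℚ.fromℤ i
  value-const i n = eq (ℚ.fromℤ i) (seq x n) (seq y n)
    where
    eq : ∀ c p q → evaluate 0ℚ 0ℚ c p q ≡ c
    eq = solve 3 (λ c p q → con 0ℚ :* p :+ con 0ℚ :* (p :+ con 1ℚ :- q) :+ c := c) refl
      where open +-*-Solver

  isCone : IsCone NonNeg
  isCone = record
    { +-closed     = λ {u} {v} hu hv → seq-≡ (value-⊕ u v) (seq-+ hu hv)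
    ; *-closed     = λ k {u} h → seq-≡ (value-⊙ (+ k) u) (seq-* k h)
    ; *-cancel     = λ k {u} h → seq-*-cancel k (seq-≡ (λ n → sym (value-⊙ (+ suc k) u n)) h)
    ; total        = λ {u} ¬h → ¬negative⇒nonNeg (value (⊝ u)) λ (ε , 0<ε , neg) →
                       ¬h $ nonNegSeq λ {ε′} 0<ε′ → eventually-map (λ n p → subst (0ℚ ℚ.<_)
                         (eq (seq (value u) n) ε ε′)
                         (difference (subst (λ q → q ℚ.+ ε ℚ.< 0ℚ) (sym (value-⊝ u n)) p) ⊹ 0<ε ⊹ 0<ε′)) neg
    ; const-nonNeg = λ n → seq-≡ (λ i → sym (value-const (+ n) i))
                       (seq-const (ℚ.nonNegative⁻¹ (ℚ.fromℤ (+ n))))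
    ; const-neg    = λ n h → never
        (λ i p → clash (ℚ.fromℤ (+ n)) p (trans (cong (ℚ._+ 1ℚ) (value-const -[1+ n ] i)) (minus-one n)))
        (eventually> h (pos 1ℚ))
    }
    where
    eq : ∀ p ε ε′ → 0ℚ ℚ.- (ℚ.- p ℚ.+ ε) ℚ.+ ε ℚ.+ ε′ ≡ p ℚ.+ ε′
    eq = solve 3 (λ p ε ε′ → con 0ℚ :- (:- p :+ ε) :+ ε :+ ε′ := p :+ ε′) refl
      where open +-*-Solver
    minus-one : ∀ n → ℚ.fromℤ -[1+ n ] ℚ.+ 1ℚ ≡ ℚ.- ℚ.fromℤ (+ n)
    minus-one zero    = refl
    minus-one (suc n) = sym (fromℤ-+ -[1+ suc n ] (+ 1))

  -- The factor k clears denominators, as forms have integer coefficients.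
  ≤⇒form : ∀ k u s t → (∀ n → ℚ.fromℤ (+ k) ℚ.* (seq t n ℚ.- seq s n) ≡ seq (value u) n) →
           s ≤ t → NonNeg u
  ≤⇒form k u s t eq s≤t = seq-≡ eq (seq-* k (≤⇒nonNeg s t s≤t))

  form⇒≤ : ∀ k u s t → (∀ n → seq (value u) n ≡ ℚ.fromℤ (+ suc k) ℚ.* (seq t n ℚ.- seq s n)) →
           NonNeg u → s ≤ t
  form⇒≤ k u s t eq h = nonNeg⇒≤ s t (seq-*-cancel k (seq-≡ eq h))

  step⇒form : ∀ a₀ a₁ a₂ → τ (x , y) (a₀ , a₁) (a₁ , a₂) →
    NonNeg (next a₀ a₁ a₂) × ¬ NonNeg (⊝ (const (+ 1) ⊕ ⊝ next a₀ a₁ a₂))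
  step⇒form a₀ a₁ .(ℤ.- k) (refl , k , (k≤s , s<1+k) , refl) =
    seq-≡ (λ n → sym (value-next n)) (≤⇒nonNeg (fromℤ k) s k≤s) , λ h → below s<1+k h
    where
    s = x * fromℤ a₀ + y * fromℤ a₁
    f = next a₀ a₁ (ℤ.- k)

    value-next : ∀ n → seq (value f) n ≡ seq s n ℚ.- ℚ.fromℤ k
    value-next n = trans
      (evaluate-cong n (fromℤ-+ a₀ a₁) (fromℤ-neg a₁)
        (trans (fromℤ-+ a₁ (ℤ.- k)) (cong (ℚ.fromℤ a₁ ℚ.+_) (fromℤ-neg k))))
      (eq (ℚ.fromℤ a₀) (ℚ.fromℤ a₁) (ℚ.fromℤ k) (seq x n) (seq y n))
      where
      eq : ∀ a₀ a₁ k p q → evaluate (a₀ ℚ.+ a₁) (ℚ.- a₁) (a₁ ℚ.+ ℚ.- k) p q ≡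
                           p ℚ.* a₀ ℚ.+ q ℚ.* a₁ ℚ.- k
      eq = solve 5 (λ a₀ a₁ k p q →
        (a₀ :+ a₁) :* p :+ (:- a₁) :* (p :+ con 1ℚ :- q) :+ (a₁ :+ (:- k)) :=
        p :* a₀ :+ q :* a₁ :- k) refl
        where open +-*-Solver

    value-1-next : ∀ n → seq (value (⊝ (const (+ 1) ⊕ ⊝ f))) n ≡ seq s n ℚ.- ℚ.fromℤ (ℤ.suc k)
    value-1-next n = begin
      seq (value (⊝ (const (+ 1) ⊕ ⊝ f))) n       ≡⟨ value-⊝ (const (+ 1) ⊕ ⊝ f) n ⟨
      ℚ.- seq (value (const (+ 1) ⊕ ⊝ f)) n       ≡⟨ cong ℚ.-_ (value-⊕ (const (+ 1)) (⊝ f) n) ⟨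
      ℚ.- (seq (value (const (+ 1))) n ℚ.+ seq (value (⊝ f)) n)
        ≡⟨ cong₂ (λ p q → ℚ.- (p ℚ.+ q)) (value-const (+ 1) n)
             (trans (sym (value-⊝ f n)) (cong ℚ.-_ (value-next n))) ⟩
      ℚ.- (1ℚ ℚ.+ ℚ.- (seq s n ℚ.- ℚ.fromℤ k))    ≡⟨ eq (seq s n) (ℚ.fromℤ k) ⟩
      seq s n ℚ.- (1ℚ ℚ.+ ℚ.fromℤ k)              ≡⟨ cong (λ p → seq s n ℚ.- p) (fromℤ-+ (+ 1) k) ⟨
      seq s n ℚ.- ℚ.fromℤ (ℤ.suc k)               ∎
      where
      open ≡-Reasoning
      eq : ∀ s k → ℚ.- (1ℚ ℚ.+ ℚ.- (s ℚ.- k)) ≡ s ℚ.- (1ℚ ℚ.+ k)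
      eq = solve 2 (λ s k → :- (con 1ℚ :+ :- (s :- k)) := s :- (con 1ℚ :+ k)) refl
        where open +-*-Solver

    below : s < fromℤ (ℤ.suc k) → ¬ NonNeg (⊝ (const (+ 1) ⊕ ⊝ f))
    below lt h = nonNeg⇒≤ (fromℤ (ℤ.suc k)) s (seq-≡ value-1-next h) lt

-- The approximations round down, so a rational upper bound for the root holds at every index and
-- not only in the limit.
approx√≤ : ∀ q c n → 0ℚ ℚ.≤ c → q ℚ.⊔ 0ℚ ℚ.≤ c ℚ.* c → approx√ q n ℚ.≤ c
approx√≤ q c n 0≤c q≤c² = ℚ.≮⇒≥ λ c<s → ℚ.<-irrefl refl (begin-strict
  c ℚ.* c                     ≤⟨ ℚ.*-monoˡ-≤-nonNeg c {{ℚ.nonNegative 0≤c}} (ℚ.<⇒≤ c<s) ⟩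
  c ℚ.* approx√ q n           <⟨ ℚ.*-monoˡ-<-pos (approx√ q n) {{ℚ.positive (ℚ.≤-<-trans 0≤c c<s)}} c<s ⟩
  approx√ q n ℚ.* approx√ q n ≤⟨ approx√-≤ q n ⟩
  q ℚ.⊔ 0ℚ                    ≤⟨ q≤c² ⟩
  c ℚ.* c                     ∎)
  where open ℚ.≤-Reasoning

-- Inequalities for the points of the region

module Region (x y : ℝ) (r∈𝓡 : 𝓡 (x , y)) (4/3≤r₀ : fromℚ (+ 4 / 3) ≤ x) where
  open Valuation x y
  open IsCone isCone

  ∉E₁ : ¬ E₁ (x , y)
  ∉E₁ = r∈𝓡 ∘ inj₁
  ∉E₂ : ¬ E₂ (x , y)
  ∉E₂ = r∈𝓡 ∘ inj₂ ∘ inj₁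
  ∉E₅ : ¬ E₅ (x , y)
  ∉E₅ = r∈𝓡 ∘ inj₂ ∘ inj₂ ∘ inj₂ ∘ inj₂ ∘ inj₁
  ∉E₆ : ¬ E₆ (x , y)
  ∉E₆ = r∈𝓡 ∘ inj₂ ∘ inj₂ ∘ inj₂ ∘ inj₂ ∘ inj₂ ∘ inj₁
  ∉E₈ : ¬ E₈ (x , y)
  ∉E₈ = r∈𝓡 ∘ inj₂ ∘ inj₂ ∘ inj₂ ∘ inj₂ ∘ inj₂ ∘ inj₂ ∘ inj₂ ∘ inj₁
  ∉E₉ : ¬ E₉ (x , y)
  ∉E₉ = r∈𝓡 ∘ inj₂ ∘ inj₂ ∘ inj₂ ∘ inj₂ ∘ inj₂ ∘ inj₂ ∘ inj₂ ∘ inj₂ ∘ inj₁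
  ∉E₁₀ : ¬ E₁₀ (x , y)
  ∉E₁₀ = r∈𝓡 ∘ inj₂ ∘ inj₂ ∘ inj₂ ∘ inj₂ ∘ inj₂ ∘ inj₂ ∘ inj₂ ∘ inj₂ ∘ inj₂

  4/3≤x : NonNeg ⟨ + 3 , + 0 , -[1+ 3 ] ⟩
  4/3≤x = ≤⇒form 3 _ (fromℚ (+ 4 / 3)) x (λ n → eq (seq x n) (seq y n)) 4/3≤r₀
    where
    eq : ∀ p q → ℚ.fromℤ (+ 3) ℚ.* (p ℚ.- + 4 / 3) ≡
                 ℚ.fromℤ (+ 3) ℚ.* p ℚ.+ 0ℚ ℚ.* (p ℚ.+ 1ℚ ℚ.- q) ℚ.+ ℚ.fromℤ -[1+ 3 ]
    eq = solve 2 (λ p q → con (ℚ.fromℤ (+ 3)) :* (p :- con (+ 4 / 3)) :=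
      con (ℚ.fromℤ (+ 3)) :* p :+ con 0ℚ :* (p :+ con 1ℚ :- q) :+ con (ℚ.fromℤ -[1+ 3 ])) refl
      where open +-*-Solver

  x>1 : Eventually (λ n → 0ℚ ℚ.< seq x n ℚ.- + 4 / 3 ℚ.+ + 1 / 4)
  x>1 = eventually> (≤⇒nonNeg (fromℚ (+ 4 / 3)) x 4/3≤r₀) (pos (+ 1 / 4))

  0<x : fromℤ (+ 0) < x
  0<x = 1ℚ , pos 1ℚ , eventually-map
    (λ n p → difference⁻ (subst (0ℚ ℚ.<_) (eq (seq x n)) (p ⊹ pos (+ 1 / 12)))) x>1
    where
    eq : ∀ p → p ℚ.- + 4 / 3 ℚ.+ + 1 / 4 ℚ.+ + 1 / 12 ≡ p ℚ.- (0ℚ ℚ.+ 1ℚ)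
    eq = solve 1 (λ p → p :- con (+ 4 / 3) :+ con (+ 1 / 4) :+ con (+ 1 / 12) :=
                        p :- (con 0ℚ :+ con 1ℚ)) refl
      where open +-*-Solver

  -- Otherwise `E₁` leaves only x + y ≤ -2. Then x ≥ 4/3 gives y ≤ -10/3, hence x - y ≥ 14/3, and
  -- the point lies in `E₆`.
  0≤r₀+r₁ : fromℤ (+ 0) ≤ x + y
  0≤r₀+r₁ r₀+r₁<0 = ∉E₆ ((r₀+r₁≤-2 , ≄-1) , λ (_ , lt) → ≯-1 lt)
    where
    r₀+r₁≤-2 : x + y ≤ - fromℤ (+ 2)
    r₀+r₁≤-2 lt = ∉E₁ (lt , r₀+r₁<0)
    low : Eventually (λ n → 0ℚ ℚ.< ℚ.- ℚ.fromℤ (+ 2) ℚ.- (seq x n ℚ.+ seq y n) ℚ.+ + 1 / 4)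
    low = eventually> (≤⇒nonNeg (x + y) (- fromℤ (+ 2)) r₀+r₁≤-2) (pos (+ 1 / 4))
    ≄-1 : ¬ (x - y ≃ - fromℤ (+ 1))
    ≄-1 eqv = never (λ n ((p , q) , r) → clash (+ 14 / 3)
        (p ⊹ p ⊹ q ⊹ difference (∣p∣<ε⇒p<ε {seq x n ℚ.- seq y n ℚ.- ℚ.- 1ℚ} r)) (eq (seq x n) (seq y n)))
      (both (both x>1 low) (eqv (pos (+ 1 / 4))))
      where
      eq : ∀ p q → (p ℚ.- + 4 / 3 ℚ.+ + 1 / 4) ℚ.+ (p ℚ.- + 4 / 3 ℚ.+ + 1 / 4)
                   ℚ.+ (ℚ.- ℚ.fromℤ (+ 2) ℚ.- (p ℚ.+ q) ℚ.+ + 1 / 4)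
                   ℚ.+ (+ 1 / 4 ℚ.- (p ℚ.- q ℚ.- ℚ.- 1ℚ)) ≡ ℚ.- (+ 14 / 3)
      eq = solve 2 (λ p q → (p :- con (+ 4 / 3) :+ con (+ 1 / 4)) :+ (p :- con (+ 4 / 3) :+ con (+ 1 / 4))
                   :+ (:- con (ℚ.fromℤ (+ 2)) :- (p :+ q) :+ con (+ 1 / 4))
                   :+ (con (+ 1 / 4) :- (p :- q :- :- con 1ℚ)) := :- con (+ 14 / 3)) refl
        where open +-*-Solver
    ≯-1 : ¬ (- fromℤ (+ 1) < y)
    ≯-1 (ε , 0<ε , lt) = never (λ n ((p , q) , r) → clash (+ 11 / 6)
        (p ⊹ q ⊹ difference r ⊹ 0<ε) (eq (seq x n) (seq y n) ε))
      (both (both x>1 low) lt)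
      where
      eq : ∀ p q ε → (p ℚ.- + 4 / 3 ℚ.+ + 1 / 4)
                   ℚ.+ (ℚ.- ℚ.fromℤ (+ 2) ℚ.- (p ℚ.+ q) ℚ.+ + 1 / 4)
                   ℚ.+ (q ℚ.- (ℚ.- 1ℚ ℚ.+ ε)) ℚ.+ ε ≡ ℚ.- (+ 11 / 6)
      eq = solve 3 (λ p q ε → (p :- con (+ 4 / 3) :+ con (+ 1 / 4))
                   :+ (:- con (ℚ.fromℤ (+ 2)) :- (p :+ q) :+ con (+ 1 / 4))
                   :+ (q :- (:- con 1ℚ :+ ε)) :+ ε := :- con (+ 11 / 6)) refl
        where open +-*-Solver

  0≤x+y : NonNeg ⟨ + 2 , -[1+ 0 ] , + 1 ⟩
  0≤x+y = ≤⇒form 1 _ (fromℤ (+ 0)) (x + y) (λ n → eq (seq x n) (seq y n)) 0≤r₀+r₁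
    where
    eq : ∀ p q → 1ℚ ℚ.* (p ℚ.+ q ℚ.- 0ℚ) ≡
                 ℚ.fromℤ (+ 2) ℚ.* p ℚ.+ ℚ.fromℤ -[1+ 0 ] ℚ.* (p ℚ.+ 1ℚ ℚ.- q) ℚ.+ 1ℚ
    eq = solve 2 (λ p q → con 1ℚ :* (p :+ q :- con 0ℚ) :=
      con (ℚ.fromℤ (+ 2)) :* p :+ con (ℚ.fromℤ -[1+ 0 ]) :* (p :+ con 1ℚ :- q) :+ con 1ℚ) refl
      where open +-*-Solver

  -1≤r₀-r₁ : - fromℤ (+ 1) ≤ x - y
  -1≤r₀-r₁ lt = ∉E₈ (lt , 0≤x)
    where
    0≤x : fromℤ (+ 0) ≤ x
    0≤x (ε , 0<ε , neg) = never (λ n (p , q) → clash (+ 13 / 12)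
        (p ⊹ difference q ⊹ 0<ε) (eq (seq x n) ε)) (both x>1 neg)
      where
      eq : ∀ p ε → (p ℚ.- + 4 / 3 ℚ.+ + 1 / 4) ℚ.+ (0ℚ ℚ.- (p ℚ.+ ε)) ℚ.+ ε ≡ ℚ.- (+ 13 / 12)
      eq = solve 2 (λ p ε → (p :- con (+ 4 / 3) :+ con (+ 1 / 4)) :+ (con 0ℚ :- (p :+ ε)) :+ ε :=
                            :- con (+ 13 / 12)) refl
        where open +-*-Solver

  -- `E₈` excludes δ < 0, and `E₂` excludes δ = 0.
  0<δ : ¬ NonNeg ⟨ + 0 , -[1+ 0 ] , + 0 ⟩
  0<δ δ≤0 = ∉E₂ λ {ε} 0<ε → eventually-map
    (λ n (p , q) → ∣p∣<ε (difference⁻ (subst (0ℚ ℚ.<_) (eq₁ (seq x n) (seq y n) ε) p))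
                         (difference⁻ (subst (0ℚ ℚ.<_) (eq₂ (seq x n) (seq y n) ε) q)))
    (both (eventually> (≤⇒nonNeg (- fromℤ (+ 1)) (x - y) -1≤r₀-r₁) 0<ε) (eventually> δ≤0 0<ε))
    where
    eq₁ : ∀ p q ε → p ℚ.- q ℚ.- ℚ.- 1ℚ ℚ.+ ε ≡ ε ℚ.- (q ℚ.- (p ℚ.+ 1ℚ))
    eq₁ = solve 3 (λ p q ε → p :- q :- :- con 1ℚ :+ ε := ε :- (q :- (p :+ con 1ℚ))) refl
      where open +-*-Solver
    eq₂ : ∀ p q ε → 0ℚ ℚ.* p ℚ.+ ℚ.fromℤ -[1+ 0 ] ℚ.* (p ℚ.+ 1ℚ ℚ.- q) ℚ.+ 0ℚ ℚ.+ ε ≡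
                    ε ℚ.- ℚ.- (q ℚ.- (p ℚ.+ 1ℚ))
    eq₂ = solve 3 (λ p q ε → con 0ℚ :* p :+ con (ℚ.fromℤ -[1+ 0 ]) :* (p :+ con 1ℚ :- q) :+ con 0ℚ :+ ε :=
                    ε :- :- (q :- (p :+ con 1ℚ))) refl
      where open +-*-Solver

  -- x ≤ 7/2 is a weak form of the bounds that E₉ and E₁₀ impose, by √2 ≤ 3/2 and √5 ≤ 5/2.
  module _ (7/2≤x : NonNeg ⟨ + 2 , + 0 , -[1+ 6 ] ⟩) where

    x-large : Eventually (λ n → 0ℚ ℚ.< seq x n ℚ.- + 27 / 8)
    x-large = eventually-map
      (λ n p → subst (0ℚ ℚ.<_) (eq (seq x n) (seq y n)) (½ ⊛ p))
      (eventually> 7/2≤x (pos (+ 1 / 4)))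
      where
      eq : ∀ p q → ½ ℚ.* (ℚ.fromℤ (+ 2) ℚ.* p ℚ.+ 0ℚ ℚ.* (p ℚ.+ 1ℚ ℚ.- q) ℚ.+ ℚ.fromℤ -[1+ 6 ] ℚ.+ + 1 / 4) ≡
                   p ℚ.- + 27 / 8
      eq = solve 2 (λ p q → con ½ :* (con (ℚ.fromℤ (+ 2)) :* p :+ con 0ℚ :* (p :+ con 1ℚ :- q)
                     :+ con (ℚ.fromℤ -[1+ 6 ]) :+ con (+ 1 / 4)) := p :- con (+ 27 / 8)) refl
        where open +-*-Solver

    -- The hypothesis does not provide the gap that -1/2 < x - y demands. Instead `E₉` refutes that
    -- inequality, which yields δ ≤ 1/2; `E₁₀` is used likewise below to reach δ ≤ 0.
    δ>1/2-absurd : ¬ NonNeg ⟨ + 0 , -[1+ 1 ] , + 1 ⟩ → ⊥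
    δ>1/2-absurd δ≰1/2 = δ≰1/2 (≤⇒form 2 _ (x - y) (- fromℚ ½) (λ n → eq (seq x n) (seq y n))
      λ lt → ∉E₉ (lt , max≤r₁ , √2-bound))
      where
      eq : ∀ p q → ℚ.fromℤ (+ 2) ℚ.* (ℚ.- ½ ℚ.- (p ℚ.- q)) ≡
                   0ℚ ℚ.* p ℚ.+ ℚ.fromℤ -[1+ 1 ] ℚ.* (p ℚ.+ 1ℚ ℚ.- q) ℚ.+ 1ℚ
      eq = solve 2 (λ p q → con (ℚ.fromℤ (+ 2)) :* (:- con ½ :- (p :- q)) :=
                   con 0ℚ :* p :+ con (ℚ.fromℤ -[1+ 1 ]) :* (p :+ con 1ℚ :- q) :+ con 1ℚ) refl
        where open +-*-Solver
      √2-bound : fromℚ (+ 3 / 2) + √ fromℤ (+ 2) < x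
      √2-bound = + 1 / 8 , pos (+ 1 / 8) , eventually-map
        (λ n p → ℚ.≤-<-trans
          (ℚ.+-monoˡ-≤ (+ 1 / 8) (ℚ.+-monoʳ-≤ (+ 3 / 2)
            (approx√≤ (ℚ.fromℤ (+ 2)) (+ 3 / 2) n (ℚ.nonNegative⁻¹ (+ 3 / 2)) (ℚ.≤ᵇ⇒≤ tt))))
          (difference⁻ (subst (0ℚ ℚ.<_) (eq′ (seq x n)) (p ⊹ pos (+ 1 / 4)))))
        x-large
        where
        eq′ : ∀ p → p ℚ.- + 27 / 8 ℚ.+ + 1 / 4 ≡ p ℚ.- (+ 3 / 2 ℚ.+ + 3 / 2 ℚ.+ + 1 / 8)
        eq′ = solve 1 (λ p → p :- con (+ 27 / 8) :+ con (+ 1 / 4) :=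
                             p :- (con (+ 3 / 2) :+ con (+ 3 / 2) :+ con (+ 1 / 8))) refl
          where open +-*-Solver
      -- The bound by -x is x + y ≥ 0. A failure can then come only from -2 √ x, and this would put
      -- the point into `E₅`.
      max≤r₁ : (- fromℤ (+ 2) * √ x) ⊔ (- x) ≤ y
      max≤r₁ (ε , 0<ε , below) = ∉E₅ (0<x , -2√x≮r₁ , 0≤r₀+r₁)
        where
        -2√x≮r₁ : ¬ (- fromℤ (+ 2) * √ x < y)
        -2√x≮r₁ (ε′ , 0<ε′ , lt) = never
          (λ n ((p , q) , r) → ℚ.<-irrefl refl (ℚ.<-≤-trans p (ℚ.⊔-lub
            (ℚ.<⇒≤ (difference⁻ (subst (0ℚ ℚ.<_) (eq₁ (seq (- fromℤ (+ 2) * √ x) n) (seq y n) ε ε′)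
              (difference q ⊹ 0<ε′ ⊹ 0<ε))))
            (ℚ.<⇒≤ (difference⁻ (subst (0ℚ ℚ.<_) (eq₂ (seq x n) (seq y n) ε) r))))))
          (both (both below lt) (eventually> (≤⇒nonNeg (fromℤ (+ 0)) (x + y) 0≤r₀+r₁) 0<ε))
          where
          eq₁ : ∀ a q ε ε′ → q ℚ.- (a ℚ.+ ε′) ℚ.+ ε′ ℚ.+ ε ≡ q ℚ.+ ε ℚ.- a
          eq₁ = solve 4 (λ a q ε ε′ → q :- (a :+ ε′) :+ ε′ :+ ε := q :+ ε :- a) refl
            where open +-*-Solver
          eq₂ : ∀ p q ε → p ℚ.+ q ℚ.- 0ℚ ℚ.+ ε ≡ q ℚ.+ ε ℚ.- ℚ.- p
          eq₂ = solve 3 (λ p q ε → p :+ q :- con 0ℚ :+ ε := q :+ ε :- :- p) refl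
            where open +-*-Solver

    δ≤1/2-absurd : NonNeg ⟨ + 0 , -[1+ 1 ] , + 1 ⟩ → ⊥
    δ≤1/2-absurd δ≤1/2 = 0<δ (≤⇒form 1 _ (x - y) (- fromℤ (+ 1)) (λ n → eq (seq x n) (seq y n))
      λ lt → ∉E₁₀ ((lt , r₀-r₁≤-1/2) , √5-bound , discriminant))
      where
      eq : ∀ p q → 1ℚ ℚ.* (ℚ.- 1ℚ ℚ.- (p ℚ.- q)) ≡
                   0ℚ ℚ.* p ℚ.+ ℚ.fromℤ -[1+ 0 ] ℚ.* (p ℚ.+ 1ℚ ℚ.- q) ℚ.+ 0ℚ
      eq = solve 2 (λ p q → con 1ℚ :* (:- con 1ℚ :- (p :- q)) :=
                   con 0ℚ :* p :+ con (ℚ.fromℤ -[1+ 0 ]) :* (p :+ con 1ℚ :- q) :+ con 0ℚ) refl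
        where open +-*-Solver
      r₀-r₁≤-1/2 : x - y ≤ - fromℚ ½
      r₀-r₁≤-1/2 = form⇒≤ 1 ⟨ + 0 , -[1+ 1 ] , + 1 ⟩ (x - y) (- fromℚ ½)
        (λ n → eq′ (seq x n) (seq y n)) δ≤1/2
        where
        eq′ : ∀ p q → 0ℚ ℚ.* p ℚ.+ ℚ.fromℤ -[1+ 1 ] ℚ.* (p ℚ.+ 1ℚ ℚ.- q) ℚ.+ 1ℚ ≡
                      ℚ.fromℤ (+ 2) ℚ.* (ℚ.- ½ ℚ.- (p ℚ.- q))
        eq′ = solve 2 (λ p q → con 0ℚ :* p :+ con (ℚ.fromℤ -[1+ 1 ]) :* (p :+ con 1ℚ :- q) :+ con 1ℚ :=
                      con (ℚ.fromℤ (+ 2)) :* (:- con ½ :- (p :- q))) refl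
          where open +-*-Solver
      gap : Eventually (λ n → 0ℚ ℚ.< ℚ.- ½ ℚ.- (seq x n ℚ.- seq y n) ℚ.+ + 1 / 8)
      gap = eventually> (≤⇒nonNeg (x - y) (- fromℚ ½) r₀-r₁≤-1/2) (pos (+ 1 / 8))
      √5-bound : fromℤ (+ 1) + √ fromℤ (+ 5) ≤ y
      √5-bound (ε , 0<ε , below) = never
        (λ n ((p , q) , r) → clash (+ 1 / 4)
          (p ⊹ q ⊹ difference (ℚ.<-≤-trans r (ℚ.+-monoʳ-≤ 1ℚ
            (approx√≤ (ℚ.fromℤ (+ 5)) (+ 5 / 2) n (ℚ.nonNegative⁻¹ (+ 5 / 2)) (ℚ.≤ᵇ⇒≤ tt)))) ⊹ 0<ε)
          (eq′ (seq x n) (seq y n) ε))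
        (both (both x-large gap) below)
        where
        eq′ : ∀ p q ε → p ℚ.- + 27 / 8 ℚ.+ (ℚ.- ½ ℚ.- (p ℚ.- q) ℚ.+ + 1 / 8)
                        ℚ.+ (1ℚ ℚ.+ + 5 / 2 ℚ.- (q ℚ.+ ε)) ℚ.+ ε ≡ ℚ.- (+ 1 / 4)
        eq′ = solve 3 (λ p q ε → p :- con (+ 27 / 8) :+ (:- con ½ :- (p :- q) :+ con (+ 1 / 8))
                        :+ (con 1ℚ :+ con (+ 5 / 2) :- (q :+ ε)) :+ ε := :- con (+ 1 / 4)) refl
          where open +-*-Solver
      -- With x = u + 27/8 and y = u + v + 15/4 all coefficients of y² − 4x are positive.
      discriminant : fromℤ (+ 4) * x ≤ y * y
      discriminant (ε , 0<ε , below) = never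
        (λ n ((p , q) , r) → clash 0ℚ
          (*-pos (p ⊹ q) (p ⊹ q) ⊹ (+ 7 / 2) ⊛ p ⊹ (+ 15 / 2) ⊛ q ⊹ pos (+ 9 / 16) ⊹ difference r ⊹ 0<ε)
          (eq′ (seq x n) (seq y n) ε))
        (both (both x-large gap) below)
        where
        eq′ : ∀ p q ε → let u = p ℚ.- + 27 / 8; v = ℚ.- ½ ℚ.- (p ℚ.- q) ℚ.+ + 1 / 8 in
          (u ℚ.+ v) ℚ.* (u ℚ.+ v) ℚ.+ + 7 / 2 ℚ.* u ℚ.+ + 15 / 2 ℚ.* v ℚ.+ + 9 / 16
          ℚ.+ (ℚ.fromℤ (+ 4) ℚ.* p ℚ.- (q ℚ.* q ℚ.+ ε)) ℚ.+ ε ≡ ℚ.- 0ℚ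
        eq′ = solve 3 (λ p q ε → let u = p :- con (+ 27 / 8); v = :- con ½ :- (p :- q) :+ con (+ 1 / 8) in
          (u :+ v) :* (u :+ v) :+ con (+ 7 / 2) :* u :+ con (+ 15 / 2) :* v :+ con (+ 9 / 16)
          :+ (con (ℚ.fromℤ (+ 4)) :* p :- (q :* q :+ ε)) :+ ε := :- con 0ℚ) refl
          where open +-*-Solver

  no-bounded-𝓡-orbit : ∀ {a} → IsOrbit (x , y) a → ∀ {m} → 1 ℕ.≤ m →
                          (∀ n → ∣ a n ∣ ℕ.≤ m) → ∀ n → ¬ ∣ a n ∣ ≡ m
  no-bounded-𝓡-orbit {a} orbit {m} 1≤m bounded n |an|≡m = by-cases ⟨ -[1+ 1 ] , + 0 , + 7 ⟩
    (λ x≤7/2 → no-bounded-orbit isCone 4/3≤x x≤7/2 0<δ 0≤x+y {a}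
      (λ k → step⇒form (a k) (a (1 ℕ.+ k)) (a (2 ℕ.+ k)) (orbit k)) bounded 1≤m n |an|≡m)
    (λ 7/2≤x → δ>1/2-absurd 7/2≤x (δ≤1/2-absurd 7/2≤x))

-- Periodic orbits

maximal-index : ∀ (b : ℕ → ℤ) k → ∃ λ i → ∀ {j} → j ℕ.< k → ∣ b j ∣ ℕ.≤ ∣ b i ∣
maximal-index b zero = 0 , λ ()
maximal-index b (suc k) with maximal-index b k
... | i , max with ∣ b k ∣ ℕ.≤? ∣ b i ∣
...   | yes bk≤bi = i , λ j<1+k → [ max , (λ { refl → bk≤bi }) ]′ (ℕ.m≤n⇒m<n∨m≡n (ℕ.s≤s⁻¹ j<1+k))
...   | no  bk≰bi = k , λ j<1+k →
        [ (λ j<k → ℕ.≤-trans (max j<k) (ℕ.≰⇒≥ bk≰bi)) , (λ { refl → ℕ.≤-refl }) ]′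
        (ℕ.m≤n⇒m<n∨m≡n (ℕ.s≤s⁻¹ j<1+k))

periodic-mod : ∀ (b : ℕ → ℤ) p .{{_ : ℕ.NonZero p}} → (∀ n → b (n ℕ.+ p) ≡ b n) →
               ∀ n → b n ≡ b (n % p)
periodic-mod b p period n = trans (cong b (m≡m%n+[m/n]*n n p)) (multiples (n ℕ./ p))
  where
  multiples : ∀ k → b (n % p ℕ.+ k ℕ.* p) ≡ b (n % p)
  multiples zero    = cong b (ℕ.+-identityʳ (n % p))
  multiples (suc k) = trans (cong b (trans (cong (n % p ℕ.+_) (ℕ.+-comm p (k ℕ.* p)))
    (sym (ℕ.+-assoc (n % p) (k ℕ.* p) p)))) (trans (period _) (multiples k))

theorem7 : 𝓡 ∩ (λ (x , y) → fromℚ (+ 4 / 3) ≤ x) ⊆ D₂⁽*⁾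
theorem7 {x , y} (r∈𝓡 , 4/3≤x) a orbit (n₀ , p@(suc _) , _ , period) = n₀ , λ n n₀≤n →
  subst (λ k → a k ≡ + 0) (ℕ.m∸n+n≡m n₀≤n) (ℤ.∣i∣≡0⇒i≡0 (ℕ.n≤0⇒n≡0
    (subst (∣ b (n ℕ.∸ n₀) ∣ ℕ.≤_) bᵢ≡0 (bounded (n ℕ.∸ n₀)))))
  where
  b : ℕ → ℤ
  b n = a (n ℕ.+ n₀)
  b-period : ∀ n → b (n ℕ.+ p) ≡ b n
  b-period n = trans
    (cong a (trans (ℕ.+-assoc n p n₀) (trans (cong (n ℕ.+_) (ℕ.+-comm p n₀)) (sym (ℕ.+-assoc n n₀ p)))))
    (period (n ℕ.+ n₀) (ℕ.m≤n+m n₀ n))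
  -- Periodicity enters here: the maximum over one period is attained and bounds the whole sequence.
  i = proj₁ (maximal-index b p)
  bounded : ∀ n → ∣ b n ∣ ℕ.≤ ∣ b i ∣
  bounded n = subst (λ j → ∣ j ∣ ℕ.≤ ∣ b i ∣) (sym (periodic-mod b p b-period n))
    (proj₂ (maximal-index b p) (m%n<n n p))
  bᵢ≡0 : ∣ b i ∣ ≡ 0
  bᵢ≡0 with ∣ b i ∣ ℕ.≟ 0
  ... | yes eq = eq
  ... | no neq = ⊥-elim (Region.no-bounded-𝓡-orbit x y r∈𝓡 4/3≤x {b} (λ n → orbit (n ℕ.+ n₀))
    (ℕ.n≢0⇒n>0 neq) bounded i refl)
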